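{- Let $f:D\to\{0,1\}$, $D\subseteq\{0,1\}^n$, be a non-constant $n$-bit partial Boolean function that depends on $k$ bits and can be computed exactly by a quantum 1-query algorithm. Then $\mathrm{rank}(G_f(1,0))\in\{1,\dots,n\}$, $\mathrm{rank}(G_f(1,1))\in\{1,\dots,n\}$, and $$\mathrm{rank}(G_f(1,0))+\mathrm{rank}(G_f(1,1))\le 2n+2-k.$$
   Context: An $n$-bit partial Boolean function is a map $f:D\to\{0,1\}$ with $D\subseteq\{0,1\}^n$. For $x\in\{0,1\}^n$ let $|P(x)\rangle_1=(1,x_1,\dots,x_n)^T\in\mathbb{R}^{n+1}$. For $b\in\{0,1\}$, $G_f(1,b)$ is the $(n+1)\times|\{x\in D:f(x)=b\}|$ matrix whose columns are the vectors $|P(x)\rangle_1$ for all $x\in D$ with $f(x)=b$. $f$ depends on $k$ bits if $k$ is the minimum, over all multilinear polynomials $p$ with $p(x)=f(x)$ for all $x\in D$, of the number of variables occurring in $p$. A quantum 1-query algorithm works in a finite-dimensional Hilbert space with orthonormal basis $\{|i,j'\rangle\}$, $i\in\{0,\dots,n\}$; the oracle is $O_x|i,j'\rangle=(-1)^{x_i}|i,j'\rangle$ for $i\ge1$, $O_x|0,j'\rangle=|0,j'\rangle$; the algorithm applies input-independent unitaries $U_0,O_x,U_1$ to an initial state and performs a projective measurement with outcomes in $\{0,1\}$; it computes $f$ exactly if for every $x\in D$ the outcome is $f(x)$ with probability 1. -}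

module Defs where

open import Algebra.Bundles.Raw using (RawRing)
import Algebra.Definitions.RawMonoid as RawMonoidDefinitions
open import Data.Bool using (Bool; true; false; if_then_else_)
import Data.Bool.Properties as Bool
open import Data.Fin using (Fin; zero; suc; _≟_)
open import Data.Fin.Subset using (Subset; _∈_; ∣_∣)
open import Data.List using (List; []; _∷_; _++_; length; filter)
import Data.List as List
open import Data.Maybe using (Maybe; just)
import Data.Maybe.Properties as Maybe
open import Data.Nat using (ℕ; zero; suc) renaming (_≤_ to _≤ⁿ_; _⊔_ to _⊔ⁿ_)
import Data.Nat.Properties as ℕ
open import Data.Product using (Σ; ∃-syntax; _×_; _,_)
open import Data.Rational as ℚ using (ℚ; 0ℚ; 1ℚ; ½)
import Data.Rational.Properties as ℚ
open import Data.Rational.Solver using (module +-*-Solver)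
open import Data.Vec using (Vec; []; _∷_; lookup)
open import Data.Vec.Functional using (Vector)
open import Function using (_⇔_)
open import Level using (0ℓ)
open import Relation.Binary.PropositionalEquality
  using (_≡_; _≢_; refl; sym; trans; cong; subst; subst₂)
open import Relation.Nullary using (¬_; yes; no)

open +-*-Solver using (solve; _:=_; _:+_; _:*_; _:-_; :-_)

-- The real numbers, as Cauchy sequences of rationals up to _≈_.

IsCauchy : (ℕ → ℚ) → Set
IsCauchy x = ∀ ε → 0ℚ ℚ.< ε →
  ∃[ N ] (∀ m n → N ≤ⁿ m → N ≤ⁿ n → ℚ.∣ x m ℚ.- x n ∣ ℚ.< ε)

record ℝ : Set where
  constructor mkℝ
  field
    seq    : ℕ → ℚ
    cauchy : IsCauchy seq

open ℝ

infix 4 _≈_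

_≈_ : ℝ → ℝ → Set
x ≈ y = ∀ ε → 0ℚ ℚ.< ε →
  ∃[ N ] (∀ n → N ≤ⁿ n → ℚ.∣ seq x n ℚ.- seq y n ∣ ℚ.< ε)

-- Abstract, so that the Cauchy proofs are never unfolded during conversion.
abstract
  half-positive : ∀ {ε} → 0ℚ ℚ.< ε → 0ℚ ℚ.< ½ ℚ.* ε
  half-positive {ε} 0<ε =
    subst (ℚ._< ½ ℚ.* ε) (ℚ.*-zeroʳ ½) (ℚ.*-monoʳ-<-pos ½ 0<ε)

  halves : ∀ ε → ½ ℚ.* ε ℚ.+ ½ ℚ.* ε ≡ ε
  halves ε = trans (sym (ℚ.*-distribʳ-+ ε ½ ½)) (ℚ.*-identityˡ ε)

  const-cauchy : ∀ q → IsCauchy (λ _ → q)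
  const-cauchy q ε 0<ε =
    0 , λ _ _ _ _ → subst (λ d → ℚ.∣ d ∣ ℚ.< ε) (sym (ℚ.+-inverseʳ q)) 0<ε

  +-cauchy : ∀ x y → IsCauchy x → IsCauchy y → IsCauchy (λ n → x n ℚ.+ y n)
  +-cauchy x y cx cy ε 0<ε
    with cx (½ ℚ.* ε) (half-positive 0<ε) | cy (½ ℚ.* ε) (half-positive 0<ε)
  ... | N , close-x | M , close-y = N ⊔ⁿ M , λ m n p q →
    subst₂ ℚ._<_
      (cong ℚ.∣_∣ (sym (rearrange (x m) (y m) (x n) (y n))))
      (halves ε)
      (ℚ.≤-<-trans (ℚ.∣p+q∣≤∣p∣+∣q∣ (x m ℚ.- x n) (y m ℚ.- y n))
        (ℚ.+-mono-<
          (close-x m n (ℕ.m⊔n≤o⇒m≤o N M p) (ℕ.m⊔n≤o⇒m≤o N M q))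
          (close-y m n (ℕ.m⊔n≤o⇒n≤o N M p) (ℕ.m⊔n≤o⇒n≤o N M q))))
    where
    rearrange : ∀ a b c d →
      (a ℚ.+ b) ℚ.- (c ℚ.+ d) ≡ (a ℚ.- c) ℚ.+ (b ℚ.- d)
    rearrange = solve 4
      (λ a b c d → (a :+ b) :- (c :+ d) := (a :- c) :+ (b :- d)) refl

  neg-cauchy : ∀ x → IsCauchy x → IsCauchy (λ n → ℚ.- x n)
  neg-cauchy x cx ε 0<ε with cx ε 0<ε
  ... | N , close = N , λ m n p q →
    subst (ℚ._< ε)
      (trans (sym (ℚ.∣-p∣≡∣p∣ (x m ℚ.- x n)))
             (cong ℚ.∣_∣ (rearrange (x m) (x n))))
      (close m n p q)
    where
    rearrange : ∀ a b → ℚ.- (a ℚ.- b) ≡ (ℚ.- a) ℚ.- (ℚ.- b)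
    rearrange = solve 2 (λ a b → :- (a :- b) := (:- a) :- (:- b)) refl

  eventually-bounded : ∀ x → IsCauchy x →
    ∃[ B ] (ℚ.Positive B × ∃[ N ] (∀ n → N ≤ⁿ n → ℚ.∣ x n ∣ ℚ.≤ B))
  eventually-bounded x cx with cx 1ℚ (ℚ.positive⁻¹ 1ℚ)
  ... | N , close =
    1ℚ ℚ.+ ℚ.∣ x N ∣ ,
    ℚ.pos+nonNeg⇒pos 1ℚ ℚ.∣ x N ∣ {{ℚ.∣-∣-nonNeg (x N)}} ,
    N , λ n N≤n →
      subst (λ d → ℚ.∣ d ∣ ℚ.≤ 1ℚ ℚ.+ ℚ.∣ x N ∣) (cancel (x n) (x N))
        (ℚ.≤-trans (ℚ.∣p+q∣≤∣p∣+∣q∣ (x n ℚ.- x N) (x N))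
          (ℚ.+-monoˡ-≤ ℚ.∣ x N ∣ (ℚ.<⇒≤ (close n N N≤n ℕ.≤-refl))))
    where
    cancel : ∀ a b → (a ℚ.- b) ℚ.+ b ≡ a
    cancel = solve 2 (λ a b → (a :- b) :+ b := a) refl

  scaled : ∀ x → IsCauchy x → ∀ B → ℚ.Positive B → ∀ ε → 0ℚ ℚ.< ε →
    ∃[ N ] (∀ m n → N ≤ⁿ m → N ≤ⁿ n → B ℚ.* ℚ.∣ x m ℚ.- x n ∣ ℚ.< ε)
  scaled x cx B B>0 ε 0<ε =
    let instance
          _ = B>0
          _ = ℚ.pos⇒nonZero B
          _ = ℚ.1/pos⇒pos B
        δ   = ℚ.1/ B ℚ.* ε
        0<δ = subst (ℚ._< δ) (ℚ.*-zeroʳ (ℚ.1/ B)) (ℚ.*-monoʳ-<-pos (ℚ.1/ B) 0<ε)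
        Bδ≡ε = trans (sym (ℚ.*-assoc B (ℚ.1/ B) ε))
                 (trans (cong (ℚ._* ε) (ℚ.*-inverseʳ B)) (ℚ.*-identityˡ ε))
        N , close = cx δ 0<δ
    in N , λ m n p q →
         subst (B ℚ.* ℚ.∣ x m ℚ.- x n ∣ ℚ.<_) Bδ≡ε
           (ℚ.*-monoʳ-<-pos B (close m n p q))

  *-cauchy : ∀ x y → IsCauchy x → IsCauchy y → IsCauchy (λ n → x n ℚ.* y n)
  *-cauchy x y cx cy ε 0<ε =
    let B , B>0 , K , x≤B = eventually-bounded x cx
        C , C>0 , L , y≤C = eventually-bounded y cy
        N , close-y = scaled y cy B B>0 (½ ℚ.* ε) (half-positive 0<ε)
        M , close-x = scaled x cx C C>0 (½ ℚ.* ε) (half-positive 0<ε)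
    in (K ⊔ⁿ L) ⊔ⁿ (N ⊔ⁿ M) , λ m n p q →
      let K⊔L≤m = ℕ.m⊔n≤o⇒m≤o (K ⊔ⁿ L) (N ⊔ⁿ M) p
          K⊔L≤n = ℕ.m⊔n≤o⇒m≤o (K ⊔ⁿ L) (N ⊔ⁿ M) q
          N⊔M≤m = ℕ.m⊔n≤o⇒n≤o (K ⊔ⁿ L) (N ⊔ⁿ M) p
          N⊔M≤n = ℕ.m⊔n≤o⇒n≤o (K ⊔ⁿ L) (N ⊔ⁿ M) q
      in subst₂ ℚ._<_
        (cong ℚ.∣_∣ (sym (rearrange (x m) (y m) (x n) (y n))))
        (halves ε)
        (ℚ.≤-<-trans
          (ℚ.∣p+q∣≤∣p∣+∣q∣ (x m ℚ.* (y m ℚ.- y n)) (y n ℚ.* (x m ℚ.- x n)))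
          (ℚ.+-mono-<
            (ℚ.≤-<-trans
              (bound (x m) (y m ℚ.- y n) (x≤B m (ℕ.m⊔n≤o⇒m≤o K L K⊔L≤m)))
              (close-y m n (ℕ.m⊔n≤o⇒m≤o N M N⊔M≤m) (ℕ.m⊔n≤o⇒m≤o N M N⊔M≤n)))
            (ℚ.≤-<-trans
              (bound (y n) (x m ℚ.- x n) (y≤C n (ℕ.m⊔n≤o⇒n≤o K L K⊔L≤n)))
              (close-x m n (ℕ.m⊔n≤o⇒n≤o N M N⊔M≤m) (ℕ.m⊔n≤o⇒n≤o N M N⊔M≤n)))))
    where
    rearrange : ∀ a b c d →
      (a ℚ.* b) ℚ.- (c ℚ.* d) ≡ a ℚ.* (b ℚ.- d) ℚ.+ d ℚ.* (a ℚ.- c)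
    rearrange = solve 4
      (λ a b c d → (a :* b) :- (c :* d) := a :* (b :- d) :+ d :* (a :- c)) refl

    bound : ∀ {B} p q → ℚ.∣ p ∣ ℚ.≤ B → ℚ.∣ p ℚ.* q ∣ ℚ.≤ B ℚ.* ℚ.∣ q ∣
    bound {B} p q ∣p∣≤B =
      subst (ℚ._≤ B ℚ.* ℚ.∣ q ∣) (sym (ℚ.∣p*q∣≡∣p∣*∣q∣ p q))
        (ℚ.*-monoʳ-≤-nonNeg ℚ.∣ q ∣ {{ℚ.∣-∣-nonNeg q}} ∣p∣≤B)

infix  8 -_
infixl 7 _*_
infixl 6 _+_

0ℝ 1ℝ : ℝ
0ℝ = mkℝ (λ _ → 0ℚ) (const-cauchy 0ℚ)
1ℝ = mkℝ (λ _ → 1ℚ) (const-cauchy 1ℚ)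

_+_ _*_ : ℝ → ℝ → ℝ
x + y = mkℝ (λ n → seq x n ℚ.+ seq y n) (+-cauchy (seq x) (seq y) (cauchy x) (cauchy y))
x * y = mkℝ (λ n → seq x n ℚ.* seq y n) (*-cauchy (seq x) (seq y) (cauchy x) (cauchy y))

-_ : ℝ → ℝ
- x = mkℝ (λ n → ℚ.- seq x n) (neg-cauchy (seq x) (cauchy x))

ℝ-rawRing : RawRing 0ℓ 0ℓ
ℝ-rawRing = record
  { Carrier = ℝ ; _≈_ = _≈_ ; _+_ = _+_ ; _*_ = _*_ ; -_ = -_
  ; 0# = 0ℝ ; 1# = 1ℝ }

open RawMonoidDefinitions (RawRing.+-rawMonoid ℝ-rawRing) public
  using () renaming (sum to ∑)

open RawMonoidDefinitions (RawRing.*-rawMonoid ℝ-rawRing) public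
  using () renaming (sum to ∏)

record ℂ : Set where
  constructor _+i_
  field
    re im : ℝ

open ℂ

infix 4 _≈ᶜ_

_≈ᶜ_ : ℂ → ℂ → Set
z ≈ᶜ w = re z ≈ re w × im z ≈ im w

infixl 7 _*ᶜ_
infixl 6 _+ᶜ_

0ᶜ 1ᶜ : ℂ
0ᶜ = 0ℝ +i 0ℝ
1ᶜ = 1ℝ +i 0ℝ

_+ᶜ_ _*ᶜ_ : ℂ → ℂ → ℂ
z +ᶜ w = (re z + re w) +i (im z + im w)
z *ᶜ w = (re z * re w + - (im z * im w)) +i (re z * im w + im z * re w)

-ᶜ_ conj : ℂ → ℂ
-ᶜ z   = (- re z) +i (- im z)
conj z = re z +i (- im z)

∣_∣² : ℂ → ℝ
∣ z ∣² = re z * re z + im z * im z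

ℂ-rawRing : RawRing 0ℓ 0ℓ
ℂ-rawRing = record
  { Carrier = ℂ ; _≈_ = _≈ᶜ_ ; _+_ = _+ᶜ_ ; _*_ = _*ᶜ_ ; -_ = -ᶜ_
  ; 0# = 0ᶜ ; 1# = 1ᶜ }

open RawMonoidDefinitions (RawRing.+-rawMonoid ℂ-rawRing) public
  using () renaming (sum to ∑ᶜ)

Matrix : ℕ → ℕ → Set
Matrix m n = Fin m → Fin n → ℝ

LinearlyIndependent : ∀ {m r} → Vector (Vector ℝ m) r → Set
LinearlyIndependent {m} {r} v =
  (a : Vector ℝ r) → (∀ i → ∑ (λ j → a j * v j i) ≈ 0ℝ) → ∀ j → a j ≈ 0ℝ

-- A family of s linearly independent columns, selected by c; independence
-- forces c to be injective.
IndependentColumns : ∀ {m n} → Matrix m n → ℕ → Set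
IndependentColumns {m} {n} M s =
  Σ (Fin s → Fin n) λ c → LinearlyIndependent {m} {s} (λ j i → M i (c j))

-- The rank is the maximal number of linearly independent columns.
IsRank : ∀ {m n} → Matrix m n → ℕ → Set
IsRank M r = IndependentColumns M r × (∀ s → IndependentColumns M s → s ≤ⁿ r)

-- The domain D is the set of inputs whose value is of the form just b.
PartialBooleanFunction : ℕ → Set
PartialBooleanFunction n = Vec Bool n → Maybe Bool

NonConstant : ∀ {n} → PartialBooleanFunction n → Set
NonConstant f = ∃[ x ] ∃[ y ] ∃[ b ] ∃[ c ] (f x ≡ just b × f y ≡ just c × b ≢ c)

bit : Bool → ℝ
bit b = if b then 1ℝ else 0ℝ

cube : ∀ n → List (Vec Bool n)
cube zero    = [] ∷ []
cube (suc n) = List.map (false ∷_) (cube n) ++ List.map (true ∷_) (cube n)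

fibre : ∀ {n} → PartialBooleanFunction n → Bool → List (Vec Bool n)
fibre {n} f b = filter (λ x → Maybe.≡-dec Bool._≟_ (f x) (just b)) (cube n)

∣P_⟩₁ : ∀ {n} → Vec Bool n → Vector ℝ (suc n)
∣P x ⟩₁ zero    = 1ℝ
∣P x ⟩₁ (suc i) = bit (lookup x i)

G₁ : ∀ {n} (f : PartialBooleanFunction n) (b : Bool) →
     Matrix (suc n) (length (fibre f b))
G₁ f b i j = ∣P List.lookup (fibre f b) j ⟩₁ i

-- p S is the coefficient of the monomial ∏_{i ∈ S} xᵢ.
MultilinearPolynomial : ℕ → Set
MultilinearPolynomial n = Subset n → ℝ

monomial : ∀ {n} → Subset n → Vector ℝ n → ℝ
monomial S v = ∏ (λ i → if lookup S i then v i else 1ℝ)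

eval : ∀ {n} → MultilinearPolynomial n → Vector ℝ n → ℝ
eval {n} p v = List.foldr (λ S acc → p S * monomial S v + acc) 0ℝ (cube n)

Represents : ∀ {n} → MultilinearPolynomial n → PartialBooleanFunction n → Set
Represents p f = ∀ x b → f x ≡ just b → eval p (λ i → bit (lookup x i)) ≈ bit b

Occurs : ∀ {n} → Fin n → MultilinearPolynomial n → Set
Occurs i p = ∃[ S ] (i ∈ S × ¬ (p S ≈ 0ℝ))

VariableCount : ∀ {n} → MultilinearPolynomial n → ℕ → Set
VariableCount {n} p m =
  Σ (Subset n) λ V → (∀ i → (i ∈ V) ⇔ Occurs i p) × ∣ V ∣ ≡ m

RepresentableWith : ∀ {n} → PartialBooleanFunction n → ℕ → Set
RepresentableWith {n} f m =
  Σ (MultilinearPolynomial n) λ p → Represents p f × VariableCount p m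

DependsOnBits : ∀ {n} → PartialBooleanFunction n → ℕ → Set
DependsOnBits f k =
  RepresentableWith f k × (∀ m → RepresentableWith f m → k ≤ⁿ m)

-- (i , j) indexes the basis vector |i,j⟩, where i ranges over {0,…,n}.
Index : ℕ → ℕ → Set
Index n d = Fin (suc n) × Fin d

State : ℕ → ℕ → Set
State n d = Index n d → ℂ

Operator : ℕ → ℕ → Set
Operator n d = Index n d → Index n d → ℂ

module _ {n d : ℕ} where

  infix  4 _≋_
  infixr 7 _·_
  infixr 8 _⊙_

  ∑ᴵ : (Index n d → ℂ) → ℂ
  ∑ᴵ g = ∑ᶜ {suc n} (λ i → ∑ᶜ {d} (λ j → g (i , j)))

  ∥_∥² : State n d → ℝ
  ∥ ψ ∥² = ∑ {suc n} (λ i → ∑ {d} (λ j → ∣ ψ (i , j) ∣²))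

  _·_ : Operator n d → State n d → State n d
  (A · ψ) s = ∑ᴵ (λ t → A s t *ᶜ ψ t)

  _⊙_ : Operator n d → Operator n d → Operator n d
  (A ⊙ B) s u = ∑ᴵ (λ t → A s t *ᶜ B t u)

  _⊕_ : Operator n d → Operator n d → Operator n d
  (A ⊕ B) s t = A s t +ᶜ B s t

  _† : Operator n d → Operator n d
  (A †) s t = conj (A t s)

  𝟘 𝟙 : Operator n d
  𝟘 _ _ = 0ᶜ
  𝟙 (i , j) (i′ , j′) with i ≟ i′ | j ≟ j′
  ... | yes _ | yes _ = 1ᶜ
  ... | _     | _     = 0ᶜ

  _≋_ : Operator n d → Operator n d → Set
  A ≋ B = ∀ s t → A s t ≈ᶜ B s t

  Unitary : Operator n d → Set
  Unitary U = (U † ⊙ U) ≋ 𝟙 × (U ⊙ U †) ≋ 𝟙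

  record IsProjectiveMeasurement (Π : Bool → Operator n d) : Set where
    field
      selfAdjoint : ∀ b → (Π b †) ≋ Π b
      idempotent  : ∀ b → (Π b ⊙ Π b) ≋ Π b
      orthogonal  : ∀ b c → b ≢ c → (Π b ⊙ Π c) ≋ 𝟘
      complete    : (Π false ⊕ Π true) ≋ 𝟙

  phase : Vec Bool n → Fin (suc n) → ℂ
  phase x zero    = 1ᶜ
  phase x (suc i) = if lookup x i then -ᶜ 1ᶜ else 1ᶜ

  oracle : Vec Bool n → State n d → State n d
  oracle x ψ (i , j) = phase x i *ᶜ ψ (i , j)

record OneQueryAlgorithm (n : ℕ) : Set where
  field
    d               : ℕ
    initial         : State n d
    initial-unit    : ∥ initial ∥² ≈ 1ℝ
    U₀ U₁           : Operator n d
    U₀-unitary      : Unitary U₀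
    U₁-unitary      : Unitary U₁
    Π               : Bool → Operator n d
    Π-measurement   : IsProjectiveMeasurement Π

  final : Vec Bool n → State n d
  final x = U₁ · oracle x (U₀ · initial)

  probability : Vec Bool n → Bool → ℝ
  probability x b = ∥ Π b · final x ∥²

ComputesExactly : ∀ {n} → OneQueryAlgorithm n → PartialBooleanFunction n → Set
ComputesExactly A f = ∀ x b → f x ≡ just b → probability x b ≈ 1ℝ
  where open OneQueryAlgorithm A

OneQueryComputable : ∀ {n} → PartialBooleanFunction n → Set
OneQueryComputable {n} f = Σ (OneQueryAlgorithm n) λ A → ComputesExactly A f

{-# OPTIONS --safe #-}

-- Let φ be the state before the query and Π₀, Π₁ the measurement.  The vector
-- Π_c U₁ O_x φ is the value at ∣P x ⟩₁ of a linear map T_c on ℝⁿ⁺¹, and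
-- exactness says that ∣P x ⟩₁ ∈ ker T_c whenever f x ≠ c.  So the columns of
-- G_f(1,b) lie in the kernel of T_{1-b}, which is proper since T_{1-b} does not
-- vanish at the inputs with value 1-b; this gives rank ≤ n.  For the sum,
-- ker T₀ ∩ ker T₁ is contained in the space where w₀ = 2 wᵢ for every bit i that φ
-- queries with nonzero amplitude, hence has dimension at most n + 1 - m, m being
-- the number of those bits, and
--   rank G_f(1,0) + rank G_f(1,1) ≤ dim (ker T₀ + ker T₁) + dim (ker T₀ ∩ ker T₁)
--                                 ≤ 2 (n + 1) - m.
-- Finally k ≤ m: the acceptance probability represents f and does not depend on
-- the bits that are never queried, so neither does its multilinear interpolation.
--
-- Equality of reals is not decidable, but the conclusions are decidable, so case
-- distinctions on reals are made under double negation.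

module Submission where

open import Algebra.Bundles using (CommutativeRing)
open import Data.Bool using (Bool; true; false; if_then_else_)
import Data.Bool.Properties as Bool
open import Data.Fin using (Fin; zero; suc; _≟_; punchIn; splitAt; join; _↑ˡ_; _↑ʳ_)
open import Data.Fin.Properties using (join-splitAt; sequence)
open import Data.Fin.Subset using (Subset; ⊥; _∈_; _∉_; ∣_∣)
open import Data.Fin.Subset.Properties using (∉⊥; ∣⊥∣≡0; p⊆q⇒∣p∣≤∣q∣; _∈?_)
open import Data.List using (List; []; _∷_; _++_; length)
import Data.List as List
open import Data.List.Membership.Propositional using () renaming (_∈_ to _∈ˡ_)
open import Data.List.Membership.Propositional.Properties
  using (∈-filter⁺; ∈-filter⁻; ∈-lookup; ∈-++⁺ˡ; ∈-++⁺ʳ; ∈-map⁺)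
open import Data.List.Relation.Unary.Any using (here; index)
open import Data.Maybe using (just)
import Data.Maybe.Properties as Maybe
open import Data.Nat as ℕ using (ℕ; zero; suc)
import Data.Nat.Properties as ℕ
open import Data.Product using (∃-syntax; _×_; _,_; proj₁; proj₂)
open import Data.Rational as ℚ using (ℚ; 0ℚ; 1ℚ; ½)
import Data.Rational.Properties as ℚ
open import Data.Rational.Solver using (module +-*-Solver)
open import Data.Sum using ([_,_]; inj₁; inj₂)
open import Data.Vec as Vec using (Vec; []; _∷_; here; there; lookup; tabulate; _[_]≔_)
open import Data.Vec.Functional as Vector using (Vector; insertAt)
import Data.Vec.Functional.Properties as Vectorₚ
open import Data.Vec.Properties
  using (lookup-++ˡ; lookup-++ʳ; lookup-replicate; []=⇒lookup; lookup⇒[]=; lookup∘tabulate; lookup∘update′)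
open import Effect.Monad using (RawMonad)
open import Function using (_∘_; _⇔_; mk⇔; Equivalence)
open import Level using (Level; 0ℓ; _⊔_)
open import Relation.Binary.PropositionalEquality as ≡ using (_≡_; _≢_)
open import Relation.Nullary
  using (¬_; Dec; yes; no; does; contradiction; decidable-stable; ¬¬-excluded-middle)
open import Relation.Nullary.Negation using (¬¬-Monad; ¬¬-map)

-- Linear algebra over stable domains

∣⊥++V∣≡∣V∣ : ∀ m {n} (V : Subset n) → ∣ ⊥ {m} Vec.++ V ∣ ≡ ∣ V ∣
∣⊥++V∣≡∣V∣ zero    V = ≡.refl
∣⊥++V∣≡∣V∣ (suc m) V = ∣⊥++V∣≡∣V∣ m V

↑ˡ∉⊥++V : ∀ {m n} (V : Subset n) (i : Fin m) → i ↑ˡ n ∉ ⊥ {m} Vec.++ V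
↑ˡ∉⊥++V {m} V i i∈ with ≡.trans (≡.sym ([]=⇒lookup i∈))
  (≡.trans (lookup-++ˡ (⊥ {m}) V i) (lookup-replicate i false))
... | ()

↑ʳ∈⊥++V⇒∈V : ∀ {m n} (V : Subset n) (i : Fin n) → m ↑ʳ i ∈ ⊥ {m} Vec.++ V → i ∈ V
↑ʳ∈⊥++V⇒∈V {m} V i i∈ =
  lookup⇒[]= i V (≡.trans (≡.sym (lookup-++ʳ (⊥ {m}) V i)) ([]=⇒lookup i∈))

module Sums {c ℓ : Level} (R : CommutativeRing c ℓ) where
  open CommutativeRing R hiding (zero)
  open import Algebra.Properties.Semiring.Sum semiring public
    using ( sum; sum-cong-≋; sum-replicate-zero; sum-remove; ∑-distrib-+; ∑-comm
          ; *-distribˡ-sum; *-distribʳ-sum)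

  sum-≈0 : ∀ {n} (f : Vector Carrier n) → (∀ i → f i ≈ 0#) → sum f ≈ 0#
  sum-≈0 {n} f f≈0 = trans (sum-cong-≋ f≈0) (sum-replicate-zero n)

  sum-++ : ∀ m {n} (f : Vector Carrier (m ℕ.+ n)) →
           sum f ≈ sum (λ i → f (i ↑ˡ n)) + sum (λ i → f (m ↑ʳ i))
  sum-++ zero    f = sym (+-identityˡ _)
  sum-++ (suc m) f = trans (+-congˡ (sum-++ m (f ∘ suc))) (sym (+-assoc _ _ _))

-- For constructive reals, failing to be zero yields no inverse. Division is therefore replaced by
-- cancellation of such a factor, and decidable equality by stability of being zero.
record IsStableDomain {c ℓ : Level} (R : CommutativeRing c ℓ) : Set (c ⊔ ℓ) where
  open CommutativeRing R
  field
    1≉0         : ¬ (1# ≈ 0#)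
    ≈0-stable   : ∀ x → ¬ ¬ (x ≈ 0#) → x ≈ 0#
    *-cancel-≉0 : ∀ x y → x * y ≈ 0# → ¬ (y ≈ 0#) → x ≈ 0#

module IndependentFamilies {c ℓ : Level} (R : CommutativeRing c ℓ) (D : IsStableDomain R) where
  open IsStableDomain D
  open CommutativeRing R hiding (zero)
  open Sums R
  open import Algebra.Properties.Ring ring using (-‿distribˡ-*; -‿distribʳ-*; -‿+-comm; -1*x≈-x)
  open import Algebra.Properties.Group +-group using (inverseˡ-unique)
  open import Algebra.Properties.CommutativeSemigroup *-commutativeSemigroup using (xy∙z≈xz∙y)
  open import Relation.Binary.Reasoning.Setoid setoid

  -- Independence after deleting the coordinates in `V`. Keeping them in the ambient space avoids
  -- reindexing the remaining ones.
  IndependentOutside : ∀ {p q} → Subset q → Vector (Vector Carrier q) p → Set _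
  IndependentOutside {p} V v = (a : Vector Carrier p) →
    (∀ i → i ∉ V → sum (λ j → a j * v j i) ≈ 0#) → ∀ j → a j ≈ 0#

  -- Fraction-free Gaussian elimination of the first coordinate with pivot row v k.
  eliminate : ∀ {p q} → Vector (Vector Carrier (suc q)) (suc p) → Fin (suc p) →
              Vector (Vector Carrier q) p
  eliminate v k j i =
    v k zero * v (punchIn k j) (suc i) - v (punchIn k j) zero * v k (suc i)

  -- A relation `a` among the eliminated rows lifts to the relation `b` among the original ones:
  -- scale `a` by the pivot and choose the coefficient of row `k` suitably. Independence makes
  -- `a j * v k zero` vanish, and the pivot cancels.
  eliminate-independent : ∀ {p q} (V : Subset q) (v : Vector (Vector Carrier (suc q)) (suc p)) k →
    ¬ (v k zero ≈ 0#) → IndependentOutside (false ∷ V) v → IndependentOutside V (eliminate v k)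
  eliminate-independent {p} V v k pivot≉0 ind a a·w≈0 j =
    *-cancel-≉0 (a j) (v k zero)
      (trans (reflexive (≡.sym (Vectorₚ.insertAt-punchIn b′ k b₀ j))) (ind b b·v≈0 (punchIn k j))) pivot≉0
    where
    b′ : Vector Carrier p
    b′ j = a j * v k zero

    S : Carrier
    S = sum (λ j → a j * v (punchIn k j) zero)

    -- This coefficient makes the combination vanish in coordinate `zero`.
    b₀ : Carrier
    b₀ = - S

    b : Vector Carrier (suc p)
    b = insertAt b′ k b₀

    expand : ∀ i → sum (λ l → b l * v l i) ≈ b₀ * v k i + sum (λ j → b′ j * v (punchIn k j) i)
    expand i = trans (sum-remove {i = k} (λ l → b l * v l i))
      (+-cong (*-congʳ (reflexive (Vectorₚ.insertAt-lookup b′ k b₀)))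
        (sum-cong-≋ {p} λ j → *-congʳ (reflexive (Vectorₚ.insertAt-punchIn b′ k b₀ j))))

    b·v≈0 : ∀ i → i ∉ false ∷ V → sum (λ l → b l * v l i) ≈ 0#
    b·v≈0 zero    _ = begin
      sum (λ l → b l * v l zero)
        ≈⟨ expand zero ⟩
      - S * v k zero + sum (λ j → a j * v k zero * v (punchIn k j) zero)
        ≈⟨ +-cong (sym (-‿distribˡ-* S (v k zero)))
             (trans (sum-cong-≋ {p} λ j → xy∙z≈xz∙y _ _ _) (sym (*-distribʳ-sum {p} (v k zero) _))) ⟩
      - (S * v k zero) + S * v k zero
        ≈⟨ -‿inverseˡ _ ⟩
      0# ∎
    b·v≈0 (suc i) i∉ = begin
      sum (λ l → b l * v l (suc i))
        ≈⟨ expand (suc i) ⟩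
      - S * v k (suc i) + sum (λ j → a j * v k zero * v (punchIn k j) (suc i))
        ≈⟨ +-comm _ _ ⟩
      sum (λ j → a j * v k zero * v (punchIn k j) (suc i)) + - S * v k (suc i)
        ≈⟨ +-cong (sum-cong-≋ {p} λ j → *-assoc _ _ _)
             (trans (*-congʳ (-‿sum {p} _))
               (trans (*-distribʳ-sum {p} _ _) (sum-cong-≋ {p} λ j →
                 trans (sym (-‿distribˡ-* _ _)) (trans (-‿cong (*-assoc _ _ _)) (-‿distribʳ-* _ _))))) ⟩
      sum (λ j → a j * (v k zero * v (punchIn k j) (suc i)))
        + sum (λ j → a j * - (v (punchIn k j) zero * v k (suc i)))
        ≈⟨ sym (∑-distrib-+ {p} _ _) ⟩
      sum (λ j → a j * (v k zero * v (punchIn k j) (suc i))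
        + a j * - (v (punchIn k j) zero * v k (suc i)))
        ≈⟨ sum-cong-≋ {p} (λ j → sym (distribˡ _ _ _)) ⟩
      sum (λ j → a j * eliminate v k j i)
        ≈⟨ a·w≈0 i (i∉ ∘ there) ⟩
      0# ∎
      where
      -‿sum : ∀ {n} (f : Vector Carrier n) → - sum f ≈ sum (λ j → - f j)
      -‿sum {zero}  f = trans (sym (+-identityʳ _)) (-‿inverseˡ 0#)
      -‿sum {suc n} f = trans (sym (-‿+-comm _ _)) (+-congˡ (-‿sum (f ∘ suc)))

  -- Induction on coordinates. One in `V` is dropped and accounts for one unit of `∣ V ∣`. Any other
  -- is dropped if all vectors vanish there; otherwise a pivot removes it together with one vector.
  independentOutside⇒≤ : ∀ {p q} (V : Subset q) (v : Vector (Vector Carrier q) p) →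
    IndependentOutside V v → p ℕ.+ ∣ V ∣ ℕ.≤ q
  independentOutside⇒≤ {zero}  []          v ind = ℕ.z≤n
  -- Without coordinates every choice of coefficients is a relation, in particular all ones.
  independentOutside⇒≤ {suc p} []          v ind = contradiction (ind (λ _ → 1#) (λ ()) zero) 1≉0
  independentOutside⇒≤ {p} {suc q} (true ∷ V) v ind =
    ≡.subst (ℕ._≤ suc q) (≡.sym (ℕ.+-suc p ∣ V ∣)) (ℕ.s≤s
      (independentOutside⇒≤ V (λ j → v j ∘ suc) λ a a·v≈0 → ind a λ
        { zero    0∉ → contradiction here 0∉
        ; (suc i) i∉ → a·v≈0 i (i∉ ∘ there) }))
  independentOutside⇒≤ {p} {suc q} (false ∷ V) v ind =
    -- Whether a pivot exists is undecidable, but the inequality is decidable, so excluded middle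
    -- may be used under double negation.
    decidable-stable (p ℕ.+ ∣ V ∣ ℕ.≤? suc q) λ ≰ → ¬¬-excluded-middle (≰ ∘ split v ind)
    where
    split : ∀ {p} (v : Vector (Vector Carrier (suc q)) p) → IndependentOutside (false ∷ V) v →
      Dec (∃[ k ] ¬ (v k zero ≈ 0#)) → p ℕ.+ ∣ V ∣ ℕ.≤ suc q
    split v ind (no ∄pivot) = ℕ.m≤n⇒m≤1+n
      (independentOutside⇒≤ V (λ j → v j ∘ suc) λ a a·v≈0 → ind a λ
        { zero    _  → sum-≈0 _ λ j →
            trans (*-congˡ (≈0-stable (v j zero) λ vj0≉0 → ∄pivot (j , vj0≉0))) (zeroʳ _)
        ; (suc i) i∉ → a·v≈0 i (i∉ ∘ there) })
    split {suc p} v ind (yes (k , pivot≉0)) =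
      ℕ.s≤s (independentOutside⇒≤ V (eliminate v k) (eliminate-independent V v k pivot≉0 ind))

  Independent : ∀ {p q} → Vector (Vector Carrier q) p → Set _
  Independent {p} v = (a : Vector Carrier p) → (∀ i → sum (λ j → a j * v j i) ≈ 0#) → ∀ j → a j ≈ 0#

  record IsSubspace {q k} (K : Vector Carrier q → Set k) : Set (c ⊔ ℓ ⊔ k) where
    field
      resp : ∀ {u v} → (∀ i → u i ≈ v i) → K u → K v
      0∈   : K (λ _ → 0#)
      +∈   : ∀ {u v} → K u → K v → K (λ i → u i + v i)
      *∈   : ∀ x {u} → K u → K (λ i → x * u i)

    combination∈ : ∀ {p} (a : Vector Carrier p) (v : Vector (Vector Carrier q) p) →
      (∀ j → K (v j)) → K (λ i → sum (λ j → a j * v j i))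
    combination∈ {zero}  a v v∈ = 0∈
    combination∈ {suc p} a v v∈ = +∈ (*∈ (a zero) (v∈ zero)) (combination∈ (a ∘ suc) (v ∘ suc) (v∈ ∘ suc))

    complement∈ : ∀ {u v} → (∀ i → u i + v i ≈ 0#) → K v → K u
    complement∈ {u} {v} u+v≈0 v∈ = resp
      (λ i → trans (-1*x≈-x (v i)) (sym (inverseˡ-unique (u i) (v i) (u+v≈0 i)))) (*∈ (- 1#) v∈)

  -- Adjoining `y` keeps the family independent: in any relation the multiple of `y` is minus an
  -- element of `K`, so its coefficient vanishes. The hypothesis on `y` is a positive way to say
  -- that `y` lies outside `K`.
  independent-proper : ∀ {p q k} {K : Vector Carrier q → Set k} → IsSubspace K →
    (y : Vector Carrier q) → (∀ x → K (λ i → x * y i) → x ≈ 0#) →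
    (v : Vector (Vector Carrier q) p) → Independent v → (∀ j → K (v j)) → p ℕ.< q
  independent-proper {p} {q} isSub y y∉ v ind v∈ = ≡.subst (ℕ._≤ q)
    (≡.trans (≡.cong (suc p ℕ.+_) (∣⊥∣≡0 q)) (ℕ.+-identityʳ (suc p)))
    (independentOutside⇒≤ ⊥ (y Vector.∷ v) λ a a·yv≈0 →
      let a₀≈0 = y∉ (a zero) (complement∈ (λ i → a·yv≈0 i ∉⊥) (combination∈ (a ∘ suc) v v∈))
      in λ { zero    → a₀≈0
           ; (suc j) → ind (a ∘ suc) (λ i →
               trans (sym (trans (+-congʳ (trans (*-congʳ a₀≈0) (zeroˡ _))) (+-identityˡ _)))
                     (a·yv≈0 i ∉⊥)) j })
    where open IsSubspace isSub

  -- dim K + dim L = dim (K + L) + dim (K ∩ L), bounding dim (K ∩ L) by the number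
  -- of coordinates that determine its elements: u ↦ (u , u) and v ↦ (v , 0) embed
  -- bases of K and L in a space of dimension 2q, where the coordinates V of the
  -- second copy are not needed for independence.
  independent-sum : ∀ {p r q k} {K L : Vector Carrier q → Set k} → IsSubspace K → IsSubspace L →
    (V : Subset q) → (∀ w → K w → L w → (∀ i → i ∉ V → w i ≈ 0#) → ∀ i → w i ≈ 0#) →
    (u : Vector (Vector Carrier q) p) → Independent u → (∀ j → K (u j)) →
    (v : Vector (Vector Carrier q) r) → Independent v → (∀ j → L (v j)) →
    p ℕ.+ r ℕ.+ ∣ V ∣ ℕ.≤ q ℕ.+ q
  independent-sum {p} {r} {q} isSubK isSubL V determined u ind-u u∈ v ind-v v∈ =
    ≡.subst (λ m → p ℕ.+ r ℕ.+ m ℕ.≤ q ℕ.+ q) (∣⊥++V∣≡∣V∣ q V)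
      (independentOutside⇒≤ (⊥ Vec.++ V) w ind-w)
    where
    module K = IsSubspace isSubK
    module L = IsSubspace isSubL

    wˡ : Vector (Vector Carrier (q ℕ.+ q)) p
    wˡ j = u j Vector.++ u j

    wʳ : Vector (Vector Carrier (q ℕ.+ q)) r
    wʳ j = v j Vector.++ (λ _ → 0#)

    w : Vector (Vector Carrier (q ℕ.+ q)) (p ℕ.+ r)
    w = wˡ Vector.++ wʳ

    ind-w : IndependentOutside (⊥ Vec.++ V) w
    ind-w a a·w≈0 l = ≡.subst (λ l → a l ≈ 0#) (join-splitAt p r l)
      ([_,_] {C = λ s → a (join p r s) ≈ 0#} α≈0 β≈0 (splitAt p l))
      where
      α : Vector Carrier p
      α j = a (j ↑ˡ r)

      β : Vector Carrier r
      β j = a (p ↑ʳ j)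

      U W : Vector Carrier q
      U i = sum (λ j → α j * u j i)
      W i = sum (λ j → β j * v j i)

      split : ∀ i → sum (λ l → a l * w l i) ≈ sum (λ j → α j * wˡ j i) + sum (λ j → β j * wʳ j i)
      split i = trans (sum-++ p (λ l → a l * w l i)) (+-cong
        (sum-cong-≋ {p} λ j → *-congˡ (reflexive (≡.cong (λ x → x i) (Vectorₚ.lookup-++ˡ wˡ wʳ j))))
        (sum-cong-≋ {r} λ j → *-congˡ (reflexive (≡.cong (λ x → x i) (Vectorₚ.lookup-++ʳ wˡ wʳ j)))))

      U+W≈0 : ∀ i → U i + W i ≈ 0#
      U+W≈0 i = trans (sym (trans (split (i ↑ˡ q)) (+-cong
        (sum-cong-≋ {p} λ j → *-congˡ (reflexive (Vectorₚ.lookup-++ˡ (u j) (u j) i)))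
        (sum-cong-≋ {r} λ j → *-congˡ (reflexive (Vectorₚ.lookup-++ˡ (v j) (λ _ → 0#) i))))))
        (a·w≈0 (i ↑ˡ q) (↑ˡ∉⊥++V V i))

      U≈0-outside : ∀ i → i ∉ V → U i ≈ 0#
      U≈0-outside i i∉V = trans (sym (trans (split (q ↑ʳ i)) (trans (+-cong
        (sum-cong-≋ {p} λ j → *-congˡ (reflexive (Vectorₚ.lookup-++ʳ (u j) (u j) i)))
        (sum-≈0 {r} _ λ j → trans
          (*-congˡ (reflexive (Vectorₚ.lookup-++ʳ (v j) (λ _ → 0#) i))) (zeroʳ _)))
        (+-identityʳ _))))
        (a·w≈0 (q ↑ʳ i) (i∉V ∘ ↑ʳ∈⊥++V⇒∈V V i))

      -- The first copy gives `U = - W`, so `U` lies in both subspaces; the second copy gives its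
      -- vanishing outside `V`.
      U≈0 : ∀ i → U i ≈ 0#
      U≈0 = determined U (K.combination∈ α u u∈)
        (L.complement∈ U+W≈0 (L.combination∈ β v v∈)) U≈0-outside

      α≈0 : ∀ j → α j ≈ 0#
      α≈0 = ind-u α U≈0

      β≈0 : ∀ j → β j ≈ 0#
      β≈0 = ind-v β λ i → trans (sym (trans (+-congʳ (U≈0 i)) (+-identityˡ _))) (U+W≈0 i)

-- Operators on a doubly indexed space

record IsConjugation {c ℓ : Level} (C : CommutativeRing c ℓ)
    (conj : CommutativeRing.Carrier C → CommutativeRing.Carrier C) : Set (c ⊔ ℓ) where
  open CommutativeRing C
  field
    conj-cong       : ∀ {x y} → x ≈ y → conj x ≈ conj y
    conj-+          : ∀ x y → conj (x + y) ≈ conj x + conj y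
    conj-*          : ∀ x y → conj (x * y) ≈ conj x * conj y
    conj-0          : conj 0# ≈ 0#

module Operators {c ℓ : Level} (C : CommutativeRing c ℓ) (m d : ℕ) where
  open CommutativeRing C hiding (zero)
  open Sums C
  open import Algebra.Properties.CommutativeSemigroup *-commutativeSemigroup using (x∙yz≈y∙xz)
  open import Relation.Binary.Reasoning.Setoid setoid

  I : Set
  I = Fin m × Fin d

  ∑₂ : (I → Carrier) → Carrier
  ∑₂ g = sum {m} (λ i → sum {d} (λ j → g (i , j)))

  ∑₂-cong : ∀ {f g} → (∀ t → f t ≈ g t) → ∑₂ f ≈ ∑₂ g
  ∑₂-cong f≈g = sum-cong-≋ {m} (λ i → sum-cong-≋ {d} (λ j → f≈g (i , j)))

  ∑₂-+ : ∀ f g → ∑₂ (λ t → f t + g t) ≈ ∑₂ f + ∑₂ g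
  ∑₂-+ f g = trans (sum-cong-≋ {m} (λ i → ∑-distrib-+ {d} _ _)) (∑-distrib-+ {m} _ _)

  ∑₂-0 : ∑₂ (λ _ → 0#) ≈ 0#
  ∑₂-0 = sum-≈0 {m} _ (λ i → sum-≈0 {d} _ (λ j → refl))

  ∑₂-*ˡ : ∀ x f → x * ∑₂ f ≈ ∑₂ (λ t → x * f t)
  ∑₂-*ˡ x f = trans (*-distribˡ-sum {m} x _) (sum-cong-≋ {m} (λ i → *-distribˡ-sum {d} x _))

  ∑₂-*ʳ : ∀ x f → ∑₂ f * x ≈ ∑₂ (λ t → f t * x)
  ∑₂-*ʳ x f = trans (*-distribʳ-sum {m} x _) (sum-cong-≋ {m} (λ i → *-distribʳ-sum {d} x _))

  ∑₂-sum-comm : ∀ {n} (h : I → Fin n → Carrier) → ∑₂ (λ t → sum (h t)) ≈ sum (λ k → ∑₂ (λ t → h t k))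
  ∑₂-sum-comm {n} h = trans
    (sum-cong-≋ {m} (λ i → ∑-comm {d} {n} (λ j k → h (i , j) k))) (∑-comm {m} {n} _)

  ∑₂-comm : ∀ (h : I → I → Carrier) → ∑₂ (λ s → ∑₂ (h s)) ≈ ∑₂ (λ t → ∑₂ (λ s → h s t))
  ∑₂-comm h = trans (∑₂-sum-comm {m} _) (sum-cong-≋ {m} (λ k → ∑₂-sum-comm {d} _))

  ∑₂-hom : (φ : Carrier → Carrier) → φ 0# ≈ 0# → (∀ x y → φ (x + y) ≈ φ x + φ y) →
           (∀ {x y} → x ≈ y → φ x ≈ φ y) → ∀ f → φ (∑₂ f) ≈ ∑₂ (φ ∘ f)
  ∑₂-hom φ φ-0 φ-+ φ-cong f = trans (hom {m} _) (sum-cong-≋ {m} (λ i → hom {d} _))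
    where
    hom : ∀ {n} (f : Vector Carrier n) → φ (sum f) ≈ sum (φ ∘ f)
    hom {zero}  f = φ-0
    hom {suc n} f = trans (φ-+ _ _) (+-congˡ (hom (f ∘ suc)))

  sum-δ : ∀ {n} (f : Vector Carrier n) i → (∀ j → j ≢ i → f j ≈ 0#) → sum f ≈ f i
  sum-δ {suc n} f zero    off = trans
    (+-congˡ (sum-≈0 {n} _ (λ j → off (suc j) λ ()))) (+-identityʳ _)
  sum-δ {suc n} f (suc i) off = trans
    (+-cong (off zero λ ()) (sum-δ (f ∘ suc) i (λ j j≢i → off (suc j) λ { ≡.refl → j≢i ≡.refl })))
    (+-identityˡ _)

  ∑₂-δ : ∀ f t → (∀ s → s ≢ t → f s ≈ 0#) → ∑₂ f ≈ f t
  ∑₂-δ f (i , j) off = trans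
    (sum-δ {m} _ i λ i′ i′≢i → sum-≈0 {d} _ λ j′ → off (i′ , j′) λ { ≡.refl → i′≢i ≡.refl })
    (sum-δ {d} _ j λ j′ j′≢j → off (i , j′) λ { ≡.refl → j′≢j ≡.refl })

  infixr 7 _·_
  _·_ : (I → I → Carrier) → (I → Carrier) → I → Carrier
  (A · ψ) s = ∑₂ (λ t → A s t * ψ t)

  ·-cong : ∀ {A B ψ χ} → (∀ s t → A s t ≈ B s t) → (∀ t → ψ t ≈ χ t) → ∀ s → (A · ψ) s ≈ (B · χ) s
  ·-cong A≈B ψ≈χ s = ∑₂-cong (λ t → *-cong (A≈B s t) (ψ≈χ t))

  ·-+ : ∀ A ψ χ s → (A · (λ t → ψ t + χ t)) s ≈ (A · ψ) s + (A · χ) s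
  ·-+ A ψ χ s = trans (∑₂-cong (λ t → distribˡ _ _ _)) (∑₂-+ _ _)

  ·-scale : ∀ A x ψ s → (A · (λ t → x * ψ t)) s ≈ x * (A · ψ) s
  ·-scale A x ψ s = trans (∑₂-cong (λ t → x∙yz≈y∙xz _ _ _)) (sym (∑₂-*ˡ x _))

  ·-0 : ∀ A ψ → (∀ t → ψ t ≈ 0#) → ∀ s → (A · ψ) s ≈ 0#
  ·-0 A ψ ψ≈0 s = trans (∑₂-cong (λ t → trans (*-congˡ (ψ≈0 t)) (zeroʳ _))) ∑₂-0

  ··-cong : ∀ A B {ψ χ} → (∀ t → ψ t ≈ χ t) → ∀ s → (A · B · ψ) s ≈ (A · B · χ) s
  ··-cong A B ψ≈χ = ·-cong {A} (λ _ _ → refl) (·-cong {B} (λ _ _ → refl) ψ≈χ)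

  ··-+ : ∀ A B ψ χ s → (A · B · (λ t → ψ t + χ t)) s ≈ (A · B · ψ) s + (A · B · χ) s
  ··-+ A B ψ χ s = trans (·-cong {A} (λ _ _ → refl) (·-+ B ψ χ) s) (·-+ A _ _ s)

  ··-scale : ∀ A B x ψ s → (A · B · (λ t → x * ψ t)) s ≈ x * (A · B · ψ) s
  ··-scale A B x ψ s = trans (·-cong {A} (λ _ _ → refl) (·-scale B x ψ) s) (·-scale A x _ s)

  ·-assoc : ∀ A B ψ s → (A · (B · ψ)) s ≈ ((λ s u → ∑₂ (λ t → A s t * B t u)) · ψ) s
  ·-assoc A B ψ s = begin
    ∑₂ (λ t → A s t * ∑₂ (λ u → B t u * ψ u))
      ≈⟨ ∑₂-cong (λ t → trans (∑₂-*ˡ _ _) (∑₂-cong (λ u → sym (*-assoc _ _ _)))) ⟩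
    ∑₂ (λ t → ∑₂ (λ u → A s t * B t u * ψ u))
      ≈⟨ ∑₂-comm _ ⟩
    ∑₂ (λ u → ∑₂ (λ t → A s t * B t u * ψ u))
      ≈⟨ ∑₂-cong (λ u → sym (∑₂-*ʳ _ _)) ⟩
    ∑₂ (λ u → ∑₂ (λ t → A s t * B t u) * ψ u) ∎

  -- Characterised by entries because `𝟙` is defined by case distinction and does not reduce on
  -- variable indices.
  IsIdentity : (I → I → Carrier) → Set ℓ
  IsIdentity E = (∀ s → E s s ≈ 1#) × (∀ s t → t ≢ s → E s t ≈ 0#)

  identity-· : ∀ {E} → IsIdentity E → ∀ ψ s → (E · ψ) s ≈ ψ s
  identity-· {E} (diagonal , off-diagonal) ψ s = trans
    (∑₂-δ (λ t → E s t * ψ t) s λ t t≢s → trans (*-congʳ (off-diagonal s t t≢s)) (zeroˡ _))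
    (trans (*-congʳ (diagonal s)) (*-identityˡ _))

  left-inverse-· : ∀ {A B E} → IsIdentity E → (∀ s u → ∑₂ (λ t → B s t * A t u) ≈ E s u) →
    ∀ ψ s → (B · (A · ψ)) s ≈ ψ s
  left-inverse-· {A} {B} isId BA≈E ψ s =
    trans (·-assoc B A ψ s) (trans (·-cong BA≈E (λ _ → refl) s) (identity-· isId ψ s))

  left-inverse⇒injective : ∀ {A B E} → IsIdentity E → (∀ s u → ∑₂ (λ t → B s t * A t u) ≈ E s u) →
    ∀ ψ → (∀ s → (A · ψ) s ≈ 0#) → ∀ s → ψ s ≈ 0#
  left-inverse⇒injective {A} {B} isId BA≈E ψ Aψ≈0 s =
    trans (sym (left-inverse-· isId BA≈E ψ s)) (·-0 B (A · ψ) Aψ≈0 s)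

  resolution-· : ∀ {A B E} → IsIdentity E → (∀ s t → A s t + B s t ≈ E s t) →
    ∀ ψ s → (A · ψ) s + (B · ψ) s ≈ ψ s
  resolution-· isId A+B≈E ψ s = trans (sym (∑₂-+ _ _)) (trans
    (∑₂-cong (λ t → trans (sym (distribʳ _ _ _)) (*-congʳ (A+B≈E s t)))) (identity-· isId ψ s))

  module InnerProduct {conj : Carrier → Carrier} (isConj : IsConjugation C conj) where
    open IsConjugation isConj

    ⟨_,_⟩ : (I → Carrier) → (I → Carrier) → Carrier
    ⟨ ψ , χ ⟩ = ∑₂ (λ t → conj (ψ t) * χ t)

    ⟨,⟩-cong : ∀ ψ {χ χ′} → (∀ t → χ t ≈ χ′ t) → ⟨ ψ , χ ⟩ ≈ ⟨ ψ , χ′ ⟩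
    ⟨,⟩-cong ψ χ≈χ′ = ∑₂-cong (λ t → *-congˡ (χ≈χ′ t))

    ⟨,⟩-+ : ∀ ψ χ χ′ → ⟨ ψ , (λ t → χ t + χ′ t) ⟩ ≈ ⟨ ψ , χ ⟩ + ⟨ ψ , χ′ ⟩
    ⟨,⟩-+ ψ χ χ′ = trans (∑₂-cong (λ t → distribˡ _ _ _)) (∑₂-+ _ _)

    adjoint : ∀ A ψ χ → ⟨ A · ψ , χ ⟩ ≈ ⟨ ψ , (λ s t → conj (A t s)) · χ ⟩
    adjoint A ψ χ = begin
      ∑₂ (λ s → conj (∑₂ (λ t → A s t * ψ t)) * χ s)
        ≈⟨ ∑₂-cong (λ s → trans
             (*-congʳ (trans (∑₂-hom conj conj-0 conj-+ conj-cong _) (∑₂-cong (λ t → conj-* _ _))))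
             (∑₂-*ʳ _ _)) ⟩
      ∑₂ (λ s → ∑₂ (λ t → conj (A s t) * conj (ψ t) * χ s))
        ≈⟨ ∑₂-comm _ ⟩
      ∑₂ (λ t → ∑₂ (λ s → conj (A s t) * conj (ψ t) * χ s))
        ≈⟨ ∑₂-cong (λ t → trans
             (∑₂-cong (λ s → trans (*-assoc _ _ _) (x∙yz≈y∙xz _ _ _))) (sym (∑₂-*ˡ _ _))) ⟩
      ∑₂ (λ t → conj (ψ t) * ∑₂ (λ s → conj (A s t) * χ s)) ∎

    -- Moving `A` to the other side of the inner product produces the adjoint times `A`, which is
    -- the identity.
    isometric : ∀ {A E} → IsIdentity E → (∀ s u → ∑₂ (λ t → conj (A t s) * A t u) ≈ E s u) →
      ∀ ψ → ⟨ A · ψ , A · ψ ⟩ ≈ ⟨ ψ , ψ ⟩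
    isometric {A} isId A†A≈E ψ =
      trans (adjoint A ψ (A · ψ)) (⟨,⟩-cong ψ (left-inverse-· isId A†A≈E ψ))

    IsProjection : (I → I → Carrier) → Set ℓ
    IsProjection P = (∀ s t → conj (P t s) ≈ P s t) × (∀ s u → ∑₂ (λ t → P s t * P t u) ≈ P s u)

    -- Moving `P` across gives its adjoint times `P`, which is `P` squared and hence `P`.
    projection-norm : ∀ {P} → IsProjection P → ∀ ψ → ⟨ P · ψ , P · ψ ⟩ ≈ ⟨ ψ , P · ψ ⟩
    projection-norm {P} (self-adjoint , idempotent) ψ = trans (adjoint P ψ (P · ψ)) (⟨,⟩-cong ψ λ s →
      trans (·-cong self-adjoint (λ _ → refl) s) (trans (·-assoc P P ψ s) (·-cong idempotent (λ _ → refl) s)))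

    -- Both norms become linear in the projection by `projection-norm`, so they add up through
    -- `P + Q = E`.
    pythagoras : ∀ {P Q E} → IsProjection P → IsProjection Q → IsIdentity E →
      (∀ s t → P s t + Q s t ≈ E s t) → ∀ ψ → ⟨ P · ψ , P · ψ ⟩ + ⟨ Q · ψ , Q · ψ ⟩ ≈ ⟨ ψ , ψ ⟩
    pythagoras isP isQ isId P+Q≈E ψ = trans (+-cong (projection-norm isP ψ) (projection-norm isQ ψ))
      (trans (sym (⟨,⟩-+ ψ _ _)) (⟨,⟩-cong ψ (resolution-· isId P+Q≈E ψ)))

open import Defs hiding (_+_; _*_)
open import Defs using () renaming (_+_ to _+ʳ_; _*_ to _*ʳ_)
open import Data.Nat using (_+_; _*_; _∸_; _≤_)
open +-*-Solver using (solve; _:=_; _:+_; _:*_; _:-_; :-_; con)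
open ≡ using (refl; sym; trans; cong; subst; subst₂)
open ℝ
open ℂ

-- Real and complex numbers

-- x ≈ y unfolds to Null (λ n → seq x n ℚ.- seq y n); since it unfolds, its
-- endpoints cannot be inferred from a proof and are passed explicitly below.
Null : (ℕ → ℚ) → Set
Null s = ∀ ε → 0ℚ ℚ.< ε → ∃[ N ] (∀ n → N ℕ.≤ n → ℚ.∣ s n ∣ ℚ.< ε)

null-resp : ∀ {s t} → (∀ n → s n ≡ t n) → Null s → Null t
null-resp s≗t s→0 ε 0<ε with s→0 ε 0<ε
... | N , small = N , λ n N≤n → subst (λ q → ℚ.∣ q ∣ ℚ.< ε) (s≗t n) (small n N≤n)

null-0 : Null (λ _ → 0ℚ)
null-0 ε 0<ε = 0 , λ _ _ → 0<ε

null-+ : ∀ {s t} → Null s → Null t → Null (λ n → s n ℚ.+ t n)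
null-+ {s} {t} s→0 t→0 ε 0<ε
  with s→0 (½ ℚ.* ε) (half-positive 0<ε) | t→0 (½ ℚ.* ε) (half-positive 0<ε)
... | N , small-s | M , small-t = N ℕ.⊔ M , λ n le →
  subst (ℚ.∣ s n ℚ.+ t n ∣ ℚ.<_) (halves ε)
    (ℚ.≤-<-trans (ℚ.∣p+q∣≤∣p∣+∣q∣ (s n) (t n))
      (ℚ.+-mono-< (small-s n (ℕ.m⊔n≤o⇒m≤o N M le)) (small-t n (ℕ.m⊔n≤o⇒n≤o N M le))))

null-neg : ∀ {s} → Null s → Null (λ n → ℚ.- s n)
null-neg {s} s→0 ε 0<ε with s→0 ε 0<ε
... | N , small = N , λ n N≤n → subst (ℚ._< ε) (sym (ℚ.∣-p∣≡∣p∣ (s n))) (small n N≤n)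

null-* : ∀ {s} (x : ℝ) → Null s → Null (λ n → seq x n ℚ.* s n)
null-* {s} x s→0 ε 0<ε =
  let B , B>0 , K , x≤B = eventually-bounded (seq x) (cauchy x)
      instance
        _ = B>0
        _ = ℚ.pos⇒nonZero B
        _ = ℚ.1/pos⇒pos B
      δ   = ℚ.1/ B ℚ.* ε
      0<δ = subst (ℚ._< δ) (ℚ.*-zeroʳ (ℚ.1/ B)) (ℚ.*-monoʳ-<-pos (ℚ.1/ B) 0<ε)
      Bδ≡ε = trans (sym (ℚ.*-assoc B (ℚ.1/ B) ε))
               (trans (cong (ℚ._* ε) (ℚ.*-inverseʳ B)) (ℚ.*-identityˡ ε))
      N , small = s→0 δ 0<δ
  in K ℕ.⊔ N , λ n le →
    subst₂ ℚ._<_ (sym (ℚ.∣p*q∣≡∣p∣*∣q∣ (seq x n) (s n))) Bδ≡ε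
      (ℚ.≤-<-trans
        (ℚ.*-monoʳ-≤-nonNeg ℚ.∣ s n ∣ {{ℚ.∣-∣-nonNeg (s n)}} (x≤B n (ℕ.m⊔n≤o⇒m≤o K N le)))
        (ℚ.*-monoʳ-<-pos B (small n (ℕ.m⊔n≤o⇒n≤o K N le))))

near : ∀ {a b ε} → ℚ.∣ a ℚ.- b ∣ ℚ.< ½ ℚ.* ε → ℚ.∣ b ∣ ℚ.< ½ ℚ.* ε → ℚ.∣ a ∣ ℚ.< ε
near {a} {b} {ε} ∣a-b∣<½ε ∣b∣<½ε =
  subst₂ ℚ._<_ (cong ℚ.∣_∣ (solve 2 (λ a b → (a :- b) :+ b := a) refl a b)) (halves ε)
    (ℚ.≤-<-trans (ℚ.∣p+q∣≤∣p∣+∣q∣ (a ℚ.- b) b) (ℚ.+-mono-< ∣a-b∣<½ε ∣b∣<½ε))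

half< : ∀ {ε} → 0ℚ ℚ.< ε → ½ ℚ.* ε ℚ.< ε
half< {ε} 0<ε = subst₂ ℚ._<_ (ℚ.+-identityˡ (½ ℚ.* ε)) (halves ε)
  (ℚ.+-monoˡ-< (½ ℚ.* ε) (half-positive 0<ε))

AwayFromZero : (ℕ → ℚ) → Set
AwayFromZero s = ∃[ δ ] (0ℚ ℚ.< δ × ∃[ N ] (∀ n → N ℕ.≤ n → δ ℚ.≤ ℚ.∣ s n ∣))

-- Pick an index after which the sequence varies by less than a quarter of `ε`, and compare the term
-- there with half of `ε`, which is decidable over `ℚ`. If it is smaller, all later terms are below
-- `ε`; if not, all later terms are at least a quarter of `ε`, so the sequence is away from zero.
¬away⇒null : ∀ {s} → IsCauchy s → ¬ AwayFromZero s → Null s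
¬away⇒null {s} cs ¬away ε 0<ε
  with cs (½ ℚ.* (½ ℚ.* ε)) (half-positive (half-positive 0<ε))
... | N , close with ℚ.∣ s N ∣ ℚ.<? ½ ℚ.* ε
... | yes small = N , λ n N≤n →
  near (ℚ.<-trans (close n N N≤n ℕ.≤-refl) (half< (half-positive 0<ε))) small
... | no large = contradiction
  ( ½ ℚ.* (½ ℚ.* ε) , half-positive (half-positive 0<ε) , N
  , λ n N≤n → ℚ.≮⇒≥ λ small → large (near (close N n ℕ.≤-refl N≤n) small))
  ¬away

null⇒¬away : ∀ {s} → Null s → ¬ AwayFromZero s
null⇒¬away s→0 (δ , 0<δ , N , away) with s→0 δ 0<δ
... | M , small = ℚ.<-irrefl refl
  (ℚ.<-≤-trans (small (N ℕ.⊔ M) (ℕ.m≤n⊔m N M)) (away (N ℕ.⊔ M) (ℕ.m≤m⊔n N M)))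

pointwise : ∀ {x y} → (∀ n → seq x n ≡ seq y n) → x ≈ y
pointwise {x} {y} x≗y = null-resp
  (λ n → sym (trans (cong (ℚ._- seq y n) (x≗y n)) (ℚ.+-inverseʳ (seq y n)))) null-0

≈-refl : ∀ {x} → x ≈ x
≈-refl {x} = pointwise {x} {x} (λ _ → refl)

≈-sym : ∀ {x y} → x ≈ y → y ≈ x
≈-sym {x} {y} x≈y = null-resp
  (λ n → solve 2 (λ a b → :- (a :- b) := b :- a) refl (seq x n) (seq y n)) (null-neg x≈y)

≈-trans : ∀ {x y z} → x ≈ y → y ≈ z → x ≈ z
≈-trans {x} {y} {z} x≈y y≈z = null-resp
  (λ n → solve 3 (λ a b c → (a :- b) :+ (b :- c) := a :- c) refl (seq x n) (seq y n) (seq z n))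
  (null-+ x≈y y≈z)

+-cong : ∀ {x y u v} → x ≈ y → u ≈ v → x +ʳ u ≈ y +ʳ v
+-cong {x} {y} {u} {v} x≈y u≈v = null-resp
  (λ n → solve 4 (λ a b c d → (a :- b) :+ (c :- d) := (a :+ c) :- (b :+ d)) refl
    (seq x n) (seq y n) (seq u n) (seq v n))
  (null-+ x≈y u≈v)

*-cong : ∀ {x y u v} → x ≈ y → u ≈ v → x *ʳ u ≈ y *ʳ v
*-cong {x} {y} {u} {v} x≈y u≈v = null-resp
  (λ n → solve 4 (λ a b c d → c :* (a :- b) :+ b :* (c :- d) := (a :* c) :- (b :* d)) refl
    (seq x n) (seq y n) (seq u n) (seq v n))
  (null-+ (null-* u x≈y) (null-* y u≈v))

-‿cong : ∀ {x y} → x ≈ y → - x ≈ - y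
-‿cong {x} {y} x≈y = null-resp
  (λ n → solve 2 (λ a b → :- (a :- b) := (:- a) :- (:- b)) refl (seq x n) (seq y n))
  (null-neg x≈y)

ℝ-ring : CommutativeRing 0ℓ 0ℓ
ℝ-ring = record
  { Carrier = ℝ ; _≈_ = _≈_ ; _+_ = _+ʳ_ ; _*_ = _*ʳ_ ; -_ = -_ ; 0# = 0ℝ ; 1# = 1ℝ
  ; isCommutativeRing = record
    { isRing = record
      { +-isAbelianGroup = record
        { isGroup = record
          { isMonoid = record
            { isSemigroup = record
              { isMagma = record
                { isEquivalence = record
                  { refl = λ {x} → ≈-refl {x}
                  ; sym = λ {x} {y} → ≈-sym {x} {y}
                  ; trans = λ {x} {y} {z} → ≈-trans {x} {y} {z} }
                ; ∙-cong = λ {x} {y} {u} {v} → +-cong {x} {y} {u} {v} }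
              ; assoc = λ x y z → pointwise {(x +ʳ y) +ʳ z} {x +ʳ (y +ʳ z)}
                  λ n → ℚ.+-assoc (seq x n) (seq y n) (seq z n) }
            ; identity =
                (λ x → pointwise {0ℝ +ʳ x} {x} λ n → ℚ.+-identityˡ (seq x n))
              , (λ x → pointwise {x +ʳ 0ℝ} {x} λ n → ℚ.+-identityʳ (seq x n)) }
          ; inverse =
              (λ x → pointwise {(- x) +ʳ x} {0ℝ} λ n → ℚ.+-inverseˡ (seq x n))
            , (λ x → pointwise {x +ʳ - x} {0ℝ} λ n → ℚ.+-inverseʳ (seq x n))
          ; ⁻¹-cong = λ {x} {y} → -‿cong {x} {y} }
        ; comm = λ x y → pointwise {x +ʳ y} {y +ʳ x} λ n → ℚ.+-comm (seq x n) (seq y n) }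
      ; *-cong = λ {x} {y} {u} {v} → *-cong {x} {y} {u} {v}
      ; *-assoc = λ x y z → pointwise {(x *ʳ y) *ʳ z} {x *ʳ (y *ʳ z)}
          λ n → ℚ.*-assoc (seq x n) (seq y n) (seq z n)
      ; *-identity =
          (λ x → pointwise {1ℝ *ʳ x} {x} λ n → ℚ.*-identityˡ (seq x n))
        , (λ x → pointwise {x *ʳ 1ℝ} {x} λ n → ℚ.*-identityʳ (seq x n))
      ; distrib =
          (λ x y z → pointwise {x *ʳ (y +ʳ z)} {x *ʳ y +ʳ x *ʳ z}
            λ n → ℚ.*-distribˡ-+ (seq x n) (seq y n) (seq z n))
        , (λ x y z → pointwise {(y +ʳ z) *ʳ x} {y *ʳ x +ʳ z *ʳ x}
            λ n → ℚ.*-distribʳ-+ (seq x n) (seq y n) (seq z n)) }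
    ; *-comm = λ x y → pointwise {x *ʳ y} {y *ʳ x} λ n → ℚ.*-comm (seq x n) (seq y n) } }

module ℝR = CommutativeRing ℝ-ring

-- Markov's principle is not available: apartness is only reached under ¬¬,
-- and ≈ 0ℝ is stable because it is the negation of being away from zero.
null⇒≈0 : ∀ {x} → Null (seq x) → x ≈ 0ℝ
null⇒≈0 {x} = null-resp (λ n → solve 1 (λ a → a := a :- con 0ℚ) refl (seq x n))

≈0⇒null : ∀ {x} → x ≈ 0ℝ → Null (seq x)
≈0⇒null {x} = null-resp (λ n → solve 1 (λ a → a :- con 0ℚ := a) refl (seq x n))

≈0-stable : ∀ x → ¬ ¬ (x ≈ 0ℝ) → x ≈ 0ℝ
≈0-stable x ¬¬x≈0 = null⇒≈0 {x} (¬away⇒null (cauchy x)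
  λ away → ¬¬x≈0 λ x≈0 → null⇒¬away (≈0⇒null {x} x≈0) away)

-- If `x` were eventually at least `δ` in absolute value, the product would bound `δ` times the
-- absolute value of `y`, forcing `y` to be null. So `x` is not away from zero.
*-cancel-≉0 : ∀ x y → x *ʳ y ≈ 0ℝ → ¬ (y ≈ 0ℝ) → x ≈ 0ℝ
*-cancel-≉0 x y xy≈0 y≉0 = null⇒≈0 {x} (¬away⇒null (cauchy x) λ away → y≉0 (null⇒≈0 {y} (y→0 away)))
  where
  y→0 : AwayFromZero (seq x) → Null (seq y)
  y→0 (δ , 0<δ , N , away) ε 0<ε =
    let instance
          δ>0 = ℚ.positive 0<δ
          _   = ℚ.pos⇒nonNeg δ
        0<δε = subst (ℚ._< δ ℚ.* ε) (ℚ.*-zeroʳ δ) (ℚ.*-monoʳ-<-pos δ 0<ε)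
        M , small = ≈0⇒null {x *ʳ y} xy≈0 (δ ℚ.* ε) 0<δε
    in N ℕ.⊔ M , λ n le → ℚ.*-cancelˡ-<-nonNeg δ
      (ℚ.≤-<-trans
        (ℚ.*-monoʳ-≤-nonNeg ℚ.∣ seq y n ∣ {{ℚ.∣-∣-nonNeg (seq y n)}}
          (away n (ℕ.m⊔n≤o⇒m≤o N M le)))
        (subst (ℚ._< δ ℚ.* ε) (ℚ.∣p*q∣≡∣p∣*∣q∣ (seq x n) (seq y n))
          (small n (ℕ.m⊔n≤o⇒n≤o N M le))))

1≉0 : ¬ (1ℝ ≈ 0ℝ)
1≉0 1≈0 with 1≈0 1ℚ (ℚ.positive⁻¹ 1ℚ)
... | N , small = ℚ.<-irrefl refl (small N ℕ.≤-refl)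

-- Nonnegativity and definiteness of the norm

-- A condition on the representing sequence, not invariant under `_≈_`. Sums of squares satisfy it
-- term by term, and that gives direct rational estimates.
NonNegative : ℝ → Set
NonNegative x = ∀ n → 0ℚ ℚ.≤ seq x n

+-nonNegative : ∀ x y → NonNegative x → NonNegative y → NonNegative (x +ʳ y)
+-nonNegative x y 0≤x 0≤y n = ℚ.+-mono-≤ (0≤x n) (0≤y n)

∑-nonNegative : ∀ {n} (f : Fin n → ℝ) → (∀ i → NonNegative (f i)) → NonNegative (∑ f)
∑-nonNegative {zero}  f 0≤f m = ℚ.≤-refl
∑-nonNegative {suc n} f 0≤f =
  +-nonNegative (f zero) (∑ (f ∘ suc)) (0≤f zero) (∑-nonNegative (f ∘ suc) (0≤f ∘ suc))

square-nonNegative : ∀ x → NonNegative (x *ʳ x)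
square-nonNegative x n = subst (0ℚ ℚ.≤_) (∣q∣∣q∣≡qq (seq x n))
  (subst (ℚ._≤ ℚ.∣ seq x n ∣ ℚ.* ℚ.∣ seq x n ∣) (ℚ.*-zeroʳ ℚ.∣ seq x n ∣)
    (ℚ.*-monoˡ-≤-nonNeg ℚ.∣ seq x n ∣ {{ℚ.∣-∣-nonNeg (seq x n)}} (ℚ.0≤∣p∣ (seq x n))))
  where
  open import Data.Sum using (inj₁; inj₂)
  ∣q∣∣q∣≡qq : ∀ q → ℚ.∣ q ∣ ℚ.* ℚ.∣ q ∣ ≡ q ℚ.* q
  ∣q∣∣q∣≡qq q with ℚ.∣p∣≡p∨∣p∣≡-p q
  ... | inj₁ eq rewrite eq = refl
  ... | inj₂ eq rewrite eq = solve 1 (λ a → (:- a) :* (:- a) := a :* a) refl q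

-- Term by term, `x` lies between zero and `x +ʳ y`.
+≈0⇒≈0 : ∀ x y → NonNegative x → NonNegative y → x +ʳ y ≈ 0ℝ → x ≈ 0ℝ
+≈0⇒≈0 x y 0≤x 0≤y x+y≈0 = null⇒≈0 {x} λ ε 0<ε →
  let N , small = ≈0⇒null {x +ʳ y} x+y≈0 ε 0<ε
  in N , λ n N≤n → ℚ.≤-<-trans (∣x∣≤∣x+y∣ n) (small n N≤n)
  where
  ∣x∣≤∣x+y∣ : ∀ n → ℚ.∣ seq x n ∣ ℚ.≤ ℚ.∣ seq (x +ʳ y) n ∣
  ∣x∣≤∣x+y∣ n = subst₂ ℚ._≤_
    (trans (ℚ.+-identityʳ (seq x n)) (sym (ℚ.0≤p⇒∣p∣≡p (0≤x n))))
    (sym (ℚ.0≤p⇒∣p∣≡p (+-nonNegative x y 0≤x 0≤y n)))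
    (ℚ.+-monoʳ-≤ (seq x n) (0≤y n))

∑≈0⇒≈0 : ∀ {n} (f : Fin n → ℝ) → (∀ i → NonNegative (f i)) → ∑ f ≈ 0ℝ → ∀ i → f i ≈ 0ℝ
∑≈0⇒≈0 f 0≤f ∑≈0 zero =
  +≈0⇒≈0 (f zero) (∑ (f ∘ suc)) (0≤f zero) (∑-nonNegative (f ∘ suc) (0≤f ∘ suc)) ∑≈0
∑≈0⇒≈0 f 0≤f ∑≈0 (suc i) =
  ∑≈0⇒≈0 (f ∘ suc) (0≤f ∘ suc)
    (+≈0⇒≈0 (∑ (f ∘ suc)) (f zero) (∑-nonNegative (f ∘ suc) (0≤f ∘ suc)) (0≤f zero)
      (≈-trans {∑ (f ∘ suc) +ʳ f zero} {∑ f} {0ℝ} (ℝR.+-comm (∑ (f ∘ suc)) (f zero)) ∑≈0))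
    i

-- By stability `x` may be assumed nonzero, and then one factor cancels.
square≈0⇒≈0 : ∀ x → x *ʳ x ≈ 0ℝ → x ≈ 0ℝ
square≈0⇒≈0 x x²≈0 = ≈0-stable x λ x≉0 → x≉0 (*-cancel-≉0 x x x²≈0 x≉0)

∣_∣²-nonNegative : ∀ z → NonNegative ∣ z ∣²
∣ z ∣²-nonNegative =
  +-nonNegative (re z *ʳ re z) (im z *ʳ im z) (square-nonNegative (re z)) (square-nonNegative (im z))

∣z∣²≈0⇒z≈0 : ∀ z → ∣ z ∣² ≈ 0ℝ → z ≈ᶜ 0ᶜ
∣z∣²≈0⇒z≈0 z ∣z∣²≈0 =
    square≈0⇒≈0 a (+≈0⇒≈0 (a *ʳ a) (b *ʳ b) (square-nonNegative a) (square-nonNegative b) ∣z∣²≈0)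
  , square≈0⇒≈0 b (+≈0⇒≈0 (b *ʳ b) (a *ʳ a) (square-nonNegative b) (square-nonNegative a)
      (≈-trans {b *ʳ b +ʳ a *ʳ a} {∣ z ∣²} {0ℝ} (ℝR.+-comm (b *ʳ b) (a *ʳ a)) ∣z∣²≈0))
  where
  a = re z
  b = im z

∥ψ∥²≈0⇒ψ≈0 : ∀ {n d} (ψ : State n d) → ∥ ψ ∥² ≈ 0ℝ → ∀ s → ψ s ≈ᶜ 0ᶜ
∥ψ∥²≈0⇒ψ≈0 ψ ∥ψ∥²≈0 (i , j) = ∣z∣²≈0⇒z≈0 (ψ (i , j))
  (∑≈0⇒≈0 (λ j → ∣ ψ (i , j) ∣²) (λ j → ∣ ψ (i , j) ∣²-nonNegative)
    (∑≈0⇒≈0 (λ i → ∑ (λ j → ∣ ψ (i , j) ∣²))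
      (λ i → ∑-nonNegative (λ j → ∣ ψ (i , j) ∣²) (λ j → ∣ ψ (i , j) ∣²-nonNegative))
      ∥ψ∥²≈0 i) j)

-- The ring of complex numbers

ℂ-ring : CommutativeRing 0ℓ 0ℓ
ℂ-ring = record
  { Carrier = ℂ ; _≈_ = _≈ᶜ_ ; _+_ = _+ᶜ_ ; _*_ = _*ᶜ_ ; -_ = -ᶜ_ ; 0# = 0ᶜ ; 1# = 1ᶜ
  ; isCommutativeRing = record
    { isRing = record
      { +-isAbelianGroup = record
        { isGroup = record
          { isMonoid = record
            { isSemigroup = record
              { isMagma = record
                { isEquivalence = record
                  { refl = λ {z} → ≈-refl {re z} , ≈-refl {im z}
                  ; sym = λ {z} {w} p → ≈-sym {re z} {re w} (proj₁ p) , ≈-sym {im z} {im w} (proj₂ p)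
                  ; trans = λ {z} {w} {v} p q →
                      ≈-trans {re z} {re w} {re v} (proj₁ p) (proj₁ q)
                    , ≈-trans {im z} {im w} {im v} (proj₂ p) (proj₂ q) }
                ; ∙-cong = λ {z} {z′} {w} {w′} p q →
                      +-cong {re z} {re z′} {re w} {re w′} (proj₁ p) (proj₁ q)
                    , +-cong {im z} {im z′} {im w} {im w′} (proj₂ p) (proj₂ q) }
              ; assoc = λ z w v → ℝR.+-assoc (re z) (re w) (re v) , ℝR.+-assoc (im z) (im w) (im v) }
            ; identity =
                (λ z → ℝR.+-identityˡ (re z) , ℝR.+-identityˡ (im z))
              , (λ z → ℝR.+-identityʳ (re z) , ℝR.+-identityʳ (im z)) }
          ; inverse =
              (λ z → ℝR.-‿inverseˡ (re z) , ℝR.-‿inverseˡ (im z))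
            , (λ z → ℝR.-‿inverseʳ (re z) , ℝR.-‿inverseʳ (im z))
          ; ⁻¹-cong = λ {z} {w} p →
              -‿cong {re z} {re w} (proj₁ p) , -‿cong {im z} {im w} (proj₂ p) }
        ; comm = λ z w → ℝR.+-comm (re z) (re w) , ℝR.+-comm (im z) (im w) }
      ; *-cong = λ {z} {z′} {w} {w′} p q → *ᶜ-cong {z} {z′} {w} {w′} p q
      ; *-assoc = *ᶜ-assoc
      ; *-identity = *ᶜ-identityˡ , λ z → ≈ᶜ-trans {z *ᶜ 1ᶜ} {1ᶜ *ᶜ z} {z} (*ᶜ-comm z 1ᶜ) (*ᶜ-identityˡ z)
      ; distrib = *ᶜ-distribˡ , λ z w v → ≈ᶜ-trans {(w +ᶜ v) *ᶜ z} {z *ᶜ (w +ᶜ v)} {w *ᶜ z +ᶜ v *ᶜ z}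
          (*ᶜ-comm (w +ᶜ v) z) (≈ᶜ-trans {z *ᶜ (w +ᶜ v)} {z *ᶜ w +ᶜ z *ᶜ v} {w *ᶜ z +ᶜ v *ᶜ z}
            (*ᶜ-distribˡ z w v)
            (+ᶜ-cong {z *ᶜ w} {w *ᶜ z} {z *ᶜ v} {v *ᶜ z} (*ᶜ-comm z w) (*ᶜ-comm z v))) }
    ; *-comm = *ᶜ-comm } }
  where
  ≈ᶜ-trans : ∀ {z w v} → z ≈ᶜ w → w ≈ᶜ v → z ≈ᶜ v
  ≈ᶜ-trans {z} {w} {v} p q =
      ≈-trans {re z} {re w} {re v} (proj₁ p) (proj₁ q)
    , ≈-trans {im z} {im w} {im v} (proj₂ p) (proj₂ q)

  +ᶜ-cong : ∀ {z z′ w w′} → z ≈ᶜ z′ → w ≈ᶜ w′ → z +ᶜ w ≈ᶜ z′ +ᶜ w′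
  +ᶜ-cong {z} {z′} {w} {w′} p q =
      +-cong {re z} {re z′} {re w} {re w′} (proj₁ p) (proj₁ q)
    , +-cong {im z} {im z′} {im w} {im w′} (proj₂ p) (proj₂ q)

  *ᶜ-cong : ∀ {z z′ w w′} → z ≈ᶜ z′ → w ≈ᶜ w′ → z *ᶜ w ≈ᶜ z′ *ᶜ w′
  *ᶜ-cong {a +i b} {a′ +i b′} {c +i e} {c′ +i e′} (p , q) (r , s) =
      +-cong {a *ʳ c} {a′ *ʳ c′} {(- (b *ʳ e))} {(- (b′ *ʳ e′))} (*-cong {a} {a′} {c} {c′} p r)
        (-‿cong {b *ʳ e} {b′ *ʳ e′} (*-cong {b} {b′} {e} {e′} q s))
    , +-cong {a *ʳ e} {a′ *ʳ e′} {b *ʳ c} {b′ *ʳ c′} (*-cong {a} {a′} {e} {e′} p s)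
        (*-cong {b} {b′} {c} {c′} q r)

  *ᶜ-assoc : ∀ z w v → (z *ᶜ w) *ᶜ v ≈ᶜ z *ᶜ (w *ᶜ v)
  *ᶜ-assoc z@(a +i b) w@(c +i e) v@(f +i g) =
      pointwise {re ((z *ᶜ w) *ᶜ v)} {re (z *ᶜ (w *ᶜ v))} (λ n → solve 6 (λ a b c e f g →
        (a :* c :+ :- (b :* e)) :* f :+ :- ((a :* e :+ b :* c) :* g)
        := a :* (c :* f :+ :- (e :* g)) :+ :- (b :* (c :* g :+ e :* f)))
        refl (seq a n) (seq b n) (seq c n) (seq e n) (seq f n) (seq g n))
    , pointwise {im ((z *ᶜ w) *ᶜ v)} {im (z *ᶜ (w *ᶜ v))} (λ n → solve 6 (λ a b c e f g →
        (a :* c :+ :- (b :* e)) :* g :+ (a :* e :+ b :* c) :* f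
        := a :* (c :* g :+ e :* f) :+ b :* (c :* f :+ :- (e :* g)))
        refl (seq a n) (seq b n) (seq c n) (seq e n) (seq f n) (seq g n))

  *ᶜ-comm : ∀ z w → z *ᶜ w ≈ᶜ w *ᶜ z
  *ᶜ-comm z@(a +i b) w@(c +i e) =
      pointwise {re (z *ᶜ w)} {re (w *ᶜ z)} (λ n → solve 4 (λ a b c e →
        a :* c :+ :- (b :* e) := c :* a :+ :- (e :* b)) refl (seq a n) (seq b n) (seq c n) (seq e n))
    , pointwise {im (z *ᶜ w)} {im (w *ᶜ z)} (λ n → solve 4 (λ a b c e →
        a :* e :+ b :* c := c :* b :+ e :* a) refl (seq a n) (seq b n) (seq c n) (seq e n))

  *ᶜ-identityˡ : ∀ z → 1ᶜ *ᶜ z ≈ᶜ z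
  *ᶜ-identityˡ z@(a +i b) =
      pointwise {re (1ᶜ *ᶜ z)} {a} (λ n → solve 2 (λ a b →
        con 1ℚ :* a :+ :- (con 0ℚ :* b) := a) refl (seq a n) (seq b n))
    , pointwise {im (1ᶜ *ᶜ z)} {b} (λ n → solve 2 (λ a b →
        con 1ℚ :* b :+ con 0ℚ :* a := b) refl (seq a n) (seq b n))

  *ᶜ-distribˡ : ∀ z w v → z *ᶜ (w +ᶜ v) ≈ᶜ z *ᶜ w +ᶜ z *ᶜ v
  *ᶜ-distribˡ z@(a +i b) w@(c +i e) v@(f +i g) =
      pointwise {re (z *ᶜ (w +ᶜ v))} {re (z *ᶜ w +ᶜ z *ᶜ v)} (λ n → solve 6 (λ a b c e f g →
        a :* (c :+ f) :+ :- (b :* (e :+ g))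
        := (a :* c :+ :- (b :* e)) :+ (a :* f :+ :- (b :* g)))
        refl (seq a n) (seq b n) (seq c n) (seq e n) (seq f n) (seq g n))
    , pointwise {im (z *ᶜ (w +ᶜ v))} {im (z *ᶜ w +ᶜ z *ᶜ v)} (λ n → solve 6 (λ a b c e f g →
        a :* (e :+ g) :+ b :* (c :+ f)
        := (a :* e :+ b :* c) :+ (a :* g :+ b :* f))
        refl (seq a n) (seq b n) (seq c n) (seq e n) (seq f n) (seq g n))

-- Multilinear interpolation

open import Algebra.Properties.CommutativeSemigroup ℝR.*-commutativeSemigroup using (x∙yz≈y∙xz)
open import Relation.Binary.Reasoning.Setoid ℝR.setoid

comprehension : ∀ {n} {P : Fin n → Set} → (∀ i → Dec (P i)) → ∃[ V ] (∀ i → (i ∈ V) ⇔ P i)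
comprehension {n} {P} P? = V , λ i → mk⇔ (sound i (P? i) ∘ lookup-V i) (complete i (P? i))
  where
  V : Subset n
  V = tabulate (λ i → does (P? i))

  lookup-V : ∀ i → i ∈ V → does (P? i) ≡ true
  lookup-V i i∈V = trans (sym (lookup∘tabulate _ i)) ([]=⇒lookup i∈V)

  sound : ∀ i (d : Dec (P i)) → does d ≡ true → P i
  sound i (yes p) _ = p

  complete : ∀ i (d : Dec (P i)) → P i → i ∈ V
  complete i _ p with P? i in eq
  ... | yes _ = lookup⇒[]= i V (trans (lookup∘tabulate _ i) (≡.cong does eq))
  ... | no ¬p = contradiction p ¬p

-- Excluded middle holds for each `P i` under double negation, and finitely many double negations
-- combine into one.
¬¬-comprehension : ∀ {n} (P : Fin n → Set) → ¬ ¬ (∃[ V ] (∀ i → (i ∈ V) ⇔ P i))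
¬¬-comprehension P = ¬¬-map (comprehension {P = P})
  (sequence (RawMonad.rawApplicative ¬¬-Monad) {P = Dec ∘ P} (λ i → ¬¬-excluded-middle))

bits : ∀ {n} → Vec Bool n → Vector ℝ n
bits x i = bit (lookup x i)

-- Möbius inversion on the cube.
interpolate : ∀ {n} → (Vec Bool n → ℝ) → MultilinearPolynomial n
interpolate {zero}  g []          = g []
interpolate {suc n} g (false ∷ S) = interpolate (λ x → g (false ∷ x)) S
interpolate {suc n} g (true  ∷ S) = interpolate (λ x → g (true ∷ x) +ʳ - g (false ∷ x)) S

sumOfTerms : ∀ {n} → MultilinearPolynomial n → Vector ℝ n → List (Subset n) → ℝ
sumOfTerms p v = List.foldr (λ S acc → p S *ʳ monomial S v +ʳ acc) 0ℝ

sumOfTerms-++ : ∀ {n} (p : MultilinearPolynomial n) v L M →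
  sumOfTerms p v (L ++ M) ≈ sumOfTerms p v L +ʳ sumOfTerms p v M
sumOfTerms-++ p v []      M =
  ≈-sym {0ℝ +ʳ sumOfTerms p v M} {sumOfTerms p v M} (ℝR.+-identityˡ (sumOfTerms p v M))
sumOfTerms-++ p v (S ∷ L) M = begin
  t +ʳ sumOfTerms p v (L ++ M)
    ≈⟨ +-cong {t} {t} {sumOfTerms p v (L ++ M)} {l +ʳ m} (≈-refl {t}) (sumOfTerms-++ p v L M) ⟩
  t +ʳ (l +ʳ m)
    ≈⟨ ℝR.+-assoc t l m ⟨
  t +ʳ l +ʳ m ∎
  where
  t = p S *ʳ monomial S v
  l = sumOfTerms p v L
  m = sumOfTerms p v M

sumOfTerms-false : ∀ {n} (p : MultilinearPolynomial (suc n)) v L →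
  sumOfTerms p v (List.map (false ∷_) L) ≈ sumOfTerms (p ∘ (false ∷_)) (v ∘ suc) L
sumOfTerms-false p v []      = ≈-refl {0ℝ}
sumOfTerms-false p v (S ∷ L) =
  +-cong {c *ʳ (1ℝ *ʳ m)} {c *ʳ m}
    {sumOfTerms p v (List.map (false ∷_) L)} {sumOfTerms (p ∘ (false ∷_)) (v ∘ suc) L}
    (*-cong {c} {c} {1ℝ *ʳ m} {m} (≈-refl {c}) (ℝR.*-identityˡ m)) (sumOfTerms-false p v L)
  where
  c = p (false ∷ S)
  m = monomial S (v ∘ suc)

sumOfTerms-true : ∀ {n} (p : MultilinearPolynomial (suc n)) v L →
  sumOfTerms p v (List.map (true ∷_) L) ≈ v zero *ʳ sumOfTerms (p ∘ (true ∷_)) (v ∘ suc) L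
sumOfTerms-true p v []      = ℝR.sym {v zero *ʳ 0ℝ} {0ℝ} (ℝR.zeroʳ (v zero))
sumOfTerms-true p v (S ∷ L) = begin
  c *ʳ (v₀ *ʳ m) +ʳ sumOfTerms p v (List.map (true ∷_) L)
    ≈⟨ +-cong {c *ʳ (v₀ *ʳ m)} {v₀ *ʳ (c *ʳ m)} {sumOfTerms p v (List.map (true ∷_) L)} {v₀ *ʳ l}
         (x∙yz≈y∙xz c v₀ m) (sumOfTerms-true p v L) ⟩
  v₀ *ʳ (c *ʳ m) +ʳ v₀ *ʳ l
    ≈⟨ ℝR.distribˡ v₀ (c *ʳ m) l ⟨
  v₀ *ʳ (c *ʳ m +ʳ l) ∎
  where
  c  = p (true ∷ S)
  v₀ = v zero
  m  = monomial S (v ∘ suc)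
  l  = sumOfTerms (p ∘ (true ∷_)) (v ∘ suc) L

-- Monomials are sorted by whether they contain the first variable, matching the recursion of both
-- `cube` and `interpolate`.
eval-step : ∀ {n} (p : MultilinearPolynomial (suc n)) v →
  eval p v ≈ eval (p ∘ (false ∷_)) (v ∘ suc) +ʳ v zero *ʳ eval (p ∘ (true ∷_)) (v ∘ suc)
eval-step {n} p v = begin
  eval p v
    ≈⟨ sumOfTerms-++ p v (List.map (false ∷_) (cube n)) (List.map (true ∷_) (cube n)) ⟩
  sumOfTerms p v (List.map (false ∷_) (cube n)) +ʳ sumOfTerms p v (List.map (true ∷_) (cube n))
    ≈⟨ +-cong {sumOfTerms p v (List.map (false ∷_) (cube n))} {eval (p ∘ (false ∷_)) (v ∘ suc)}
              {sumOfTerms p v (List.map (true ∷_) (cube n))} {v zero *ʳ eval (p ∘ (true ∷_)) (v ∘ suc)}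
         (sumOfTerms-false p v (cube n)) (sumOfTerms-true p v (cube n)) ⟩
  eval (p ∘ (false ∷_)) (v ∘ suc) +ʳ v zero *ʳ eval (p ∘ (true ∷_)) (v ∘ suc) ∎

-- In the first variable the polynomial is the affine function through the two restrictions of `g`,
-- which is exact at both values of a bit.
eval-interpolate : ∀ {n} (g : Vec Bool n → ℝ) x → eval (interpolate g) (bits x) ≈ g x
eval-interpolate g [] = begin
  g [] *ʳ 1ℝ +ʳ 0ℝ ≈⟨ ℝR.+-identityʳ (g [] *ʳ 1ℝ) ⟩
  g [] *ʳ 1ℝ      ≈⟨ ℝR.*-identityʳ (g []) ⟩
  g []           ∎
eval-interpolate g (b ∷ x) = begin
  eval (interpolate g) (bits (b ∷ x))
    ≈⟨ eval-step (interpolate g) (bits (b ∷ x)) ⟩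
  E₀ +ʳ bit b *ʳ E₁
    ≈⟨ +-cong {E₀} {g₀} {bit b *ʳ E₁} {bit b *ʳ (g₁ +ʳ - g₀)} (eval-interpolate (g ∘ (false ∷_)) x)
         (*-cong {bit b} {bit b} {E₁} {g₁ +ʳ - g₀} (≈-refl {bit b})
           (eval-interpolate (λ x → g (true ∷ x) +ʳ - g (false ∷ x)) x)) ⟩
  g₀ +ʳ bit b *ʳ (g₁ +ʳ - g₀)
    ≈⟨ select b ⟩
  g (b ∷ x) ∎
  where
  E₀ = eval (interpolate (g ∘ (false ∷_))) (bits x)
  E₁ = eval (interpolate (λ x → g (true ∷ x) +ʳ - g (false ∷ x))) (bits x)
  g₀ = g (false ∷ x)
  g₁ = g (true ∷ x)

  select : ∀ b → g₀ +ʳ bit b *ʳ (g₁ +ʳ - g₀) ≈ g (b ∷ x)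
  select false = pointwise {g₀ +ʳ 0ℝ *ʳ (g₁ +ʳ - g₀)} {g₀} λ n →
    solve 2 (λ a b → a :+ con 0ℚ :* (b :+ :- a) := a) refl (seq g₀ n) (seq g₁ n)
  select true = pointwise {g₀ +ʳ 1ℝ *ʳ (g₁ +ʳ - g₀)} {g₁} λ n →
    solve 2 (λ a b → a :+ con 1ℚ :* (b :+ :- a) := b) refl (seq g₀ n) (seq g₁ n)

Ignores : ∀ {n} → Fin n → (Vec Bool n → ℝ) → Set
Ignores i g = ∀ x → g (x [ i ]≔ true) ≈ g (x [ i ]≔ false)

x-y≈0 : ∀ {x y} → x ≈ y → x +ʳ - y ≈ 0ℝ
x-y≈0 {x} {y} x≈y = ≈-trans {x +ʳ - y} {y +ʳ - y} {0ℝ}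
  (+-cong {x} {y} {(- y)} {(- y)} x≈y (≈-refl {(- y)})) (ℝR.-‿inverseʳ y)

interpolate-≈0 : ∀ {n} (g : Vec Bool n → ℝ) → (∀ x → g x ≈ 0ℝ) → ∀ S → interpolate g S ≈ 0ℝ
interpolate-≈0 {zero}  g g≈0 []          = g≈0 []
interpolate-≈0 {suc n} g g≈0 (false ∷ S) = interpolate-≈0 (g ∘ (false ∷_)) (λ x → g≈0 (false ∷ x)) S
interpolate-≈0 {suc n} g g≈0 (true  ∷ S) = interpolate-≈0 _
  (λ x → x-y≈0 {g (true ∷ x)} {g (false ∷ x)}
    (≈-trans {g (true ∷ x)} {0ℝ} {g (false ∷ x)} (g≈0 (true ∷ x))
      (≈-sym {g (false ∷ x)} {0ℝ} (g≈0 (false ∷ x))))) S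

-- The coefficient at `S` is an iterated difference in the directions of `S`. Differences and
-- restrictions in other directions preserve ignoring `i`, and the difference in direction `i` is
-- identically zero.
ignored⇒coefficient≈0 : ∀ {n} (g : Vec Bool n → ℝ) i → Ignores i g →
  ∀ S → i ∈ S → interpolate g S ≈ 0ℝ
ignored⇒coefficient≈0 g zero ig (true ∷ S) here =
  -- The head bit of the argument of `ig` is overwritten, so its value is arbitrary.
  interpolate-≈0 _ (λ x → x-y≈0 {g (true ∷ x)} {g (false ∷ x)} (ig (true ∷ x))) S
ignored⇒coefficient≈0 g (suc i) ig (false ∷ S) (there i∈S) =
  ignored⇒coefficient≈0 (g ∘ (false ∷_)) i (λ x → ig (false ∷ x)) S i∈S
ignored⇒coefficient≈0 g (suc i) ig (true ∷ S) (there i∈S) =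
  ignored⇒coefficient≈0 _ i (λ x →
    +-cong {g (true ∷ x [ i ]≔ true)} {g (true ∷ x [ i ]≔ false)}
           {(- g (false ∷ x [ i ]≔ true))} {(- g (false ∷ x [ i ]≔ false))} (ig (true ∷ x))
      (-‿cong {g (false ∷ x [ i ]≔ true)} {g (false ∷ x [ i ]≔ false)} (ig (false ∷ x)))) S i∈S

-- The interpolation of `g` represents `f`, and its variables all lie in `V`. Their exact set,
-- needed for minimality, exists only under double negation, which suffices for the decidable
-- conclusion.
dependsOnBits⇒≤ : ∀ {n k} {f : PartialBooleanFunction n} → DependsOnBits f k →
  (g : Vec Bool n → ℝ) → (∀ x b → f x ≡ just b → g x ≈ bit b) →
  (V : Subset n) → (∀ i → i ∉ V → Ignores i g) → k ℕ.≤ ∣ V ∣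
dependsOnBits⇒≤ {n} {k} (_ , minimal) g g≈f V ignores =
  decidable-stable (k ℕ.≤? ∣ V ∣) (¬¬-map bound (¬¬-comprehension (λ i → Occurs i p)))
  where
  p : MultilinearPolynomial n
  p = interpolate g

  bound : ∃[ W ] (∀ i → (i ∈ W) ⇔ Occurs i p) → k ℕ.≤ ∣ V ∣
  bound (W , W⇔occurs) = ℕ.≤-trans
    (minimal ∣ W ∣ (p , represents , W , W⇔occurs , refl)) (p⊆q⇒∣p∣≤∣q∣ W⊆V)
    where
    represents : ∀ x b → _ → eval p (bits x) ≈ bit b
    represents x b fx≡b = ≈-trans {eval p (bits x)} {g x} {bit b} (eval-interpolate g x) (g≈f x b fx≡b)

    W⊆V : ∀ {i} → i ∈ W → i ∈ V
    W⊆V {i} i∈W with i ∈? V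
    ... | yes i∈V = i∈V
    ... | no  i∉V with Equivalence.to (W⇔occurs i) i∈W
    ...   | S , i∈S , pS≉0 = contradiction (ignored⇒coefficient≈0 g i (ignores i i∉V) S i∈S) pS≉0

-- Norms and the query

module ℂR = CommutativeRing ℂ-ring
open import Algebra.Properties.Ring ℂR.ring using (-1*x≈-x)

ℝ-stableDomain : IsStableDomain ℝ-ring
ℝ-stableDomain = record { 1≉0 = 1≉0 ; ≈0-stable = ≈0-stable ; *-cancel-≉0 = *-cancel-≉0 }

open IndependentFamilies ℝ-ring ℝ-stableDomain using (IsSubspace; independent-proper; independent-sum)

conj-isConjugation : IsConjugation ℂ-ring conj
conj-isConjugation = record
  { conj-cong = λ {z} {w} p → proj₁ p , -‿cong {im z} {im w} (proj₂ p)
  ; conj-+ = λ { z@(a +i b) w@(c +i e) →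
      ≈-refl {a +ʳ c}
    , pointwise { - (b +ʳ e)} { - b +ʳ - e}
        (λ n → solve 2 (λ b e → :- (b :+ e) := :- b :+ :- e) refl (seq b n) (seq e n)) }
  ; conj-* = λ { z@(a +i b) w@(c +i e) →
      pointwise {re (conj (z *ᶜ w))} {re (conj z *ᶜ conj w)} (λ n → solve 4 (λ a b c e →
        a :* c :+ :- (b :* e) := a :* c :+ :- ((:- b) :* (:- e)))
        refl (seq a n) (seq b n) (seq c n) (seq e n))
    , pointwise {im (conj (z *ᶜ w))} {im (conj z *ᶜ conj w)} (λ n → solve 4 (λ a b c e →
        :- (a :* e :+ b :* c) := a :* (:- e) :+ (:- b) :* c)
        refl (seq a n) (seq b n) (seq c n) (seq e n)) }
  ; conj-0 = ≈-refl {0ℝ} , pointwise { - 0ℝ} {0ℝ} (λ n → refl) }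

ι : ℝ → ℂ
ι x = x +i 0ℝ

ι-* : ∀ x z → ι x *ᶜ z ≈ᶜ (x *ʳ re z) +i (x *ʳ im z)
ι-* x z@(a +i b) =
    pointwise {re (ι x *ᶜ z)} {x *ʳ a} (λ n →
      trans (cong (λ q → seq x n ℚ.* seq a n ℚ.- q) (ℚ.*-zeroˡ (seq b n))) (ℚ.+-identityʳ _))
  , pointwise {im (ι x *ᶜ z)} {x *ʳ b} (λ n →
      trans (cong (seq x n ℚ.* seq b n ℚ.+_) (ℚ.*-zeroˡ (seq a n))) (ℚ.+-identityʳ _))

*ᶜ-cancel-≉0 : ∀ x z → ι x *ᶜ z ≈ᶜ 0ᶜ → ¬ (x ≈ 0ℝ) → z ≈ᶜ 0ᶜ
*ᶜ-cancel-≉0 x z xz≈0 x≉0 =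
    cancel (re z) (re (ι x *ᶜ z)) (proj₁ (ι-* x z)) (proj₁ xz≈0)
  , cancel (im z) (im (ι x *ᶜ z)) (proj₂ (ι-* x z)) (proj₂ xz≈0)
  where
  cancel : ∀ a y → y ≈ x *ʳ a → y ≈ 0ℝ → a ≈ 0ℝ
  cancel a y y≈xa y≈0 = *-cancel-≉0 a x
    (≈-trans {a *ʳ x} {x *ʳ a} {0ℝ} (ℝR.*-comm a x)
      (≈-trans {x *ʳ a} {y} {0ℝ} (≈-sym {y} {x *ʳ a} y≈xa) y≈0)) x≉0

half-cancel : ∀ x → x +ʳ x ≈ 0ℝ → x ≈ 0ℝ
half-cancel x x+x≈0 = ≈-trans {x} {h *ʳ (x +ʳ x)} {0ℝ}
  (pointwise {x} {h *ʳ (x +ʳ x)} λ n →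
    trans (sym (halves (seq x n))) (sym (ℚ.*-distribˡ-+ ½ (seq x n) (seq x n))))
  (≈-trans {h *ʳ (x +ʳ x)} {h *ʳ 0ℝ} {0ℝ}
    (*-cong {h} {h} {x +ʳ x} {0ℝ} (≈-refl {h}) x+x≈0) (ℝR.zeroʳ h))
  where
  h : ℝ
  h = mkℝ (λ _ → ½) (const-cauchy ½)

∑-cong : ∀ {n} (f g : Vector ℝ n) → (∀ i → f i ≈ g i) → ∑ f ≈ ∑ g
∑-cong f g f≈g = Sums.sum-cong-≋ ℝ-ring {x = f} {y = g} f≈g

re-∑ᶜ : ∀ {n} (f : Vector ℂ n) → re (∑ᶜ f) ≡ ∑ (re ∘ f)
re-∑ᶜ {zero}  f = refl
re-∑ᶜ {suc n} f = cong (re (f zero) +ʳ_) (re-∑ᶜ (f ∘ suc))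

∣∣²-cong : ∀ z w → z ≈ᶜ w → ∣ z ∣² ≈ ∣ w ∣²
∣∣²-cong (a +i b) (c +i e) (p , q) =
  +-cong {a *ʳ a} {c *ʳ c} {b *ʳ b} {e *ʳ e} (*-cong {a} {c} {a} {c} p p) (*-cong {b} {e} {b} {e} q q)

module _ {n d : ℕ} where
  open Operators ℂ-ring (suc n) d
    using (module InnerProduct; IsIdentity; left-inverse⇒injective; resolution-·)
  open InnerProduct conj-isConjugation

  ∥∥²-cong : ∀ (ψ χ : State n d) → (∀ s → ∣ ψ s ∣² ≈ ∣ χ s ∣²) → ∥ ψ ∥² ≈ ∥ χ ∥²
  ∥∥²-cong ψ χ ψ≈χ = ∑-cong (λ i → ∑ (λ j → ∣ ψ (i , j) ∣²)) (λ i → ∑ (λ j → ∣ χ (i , j) ∣²)) λ i →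
    ∑-cong (λ j → ∣ ψ (i , j) ∣²) (λ j → ∣ χ (i , j) ∣²) λ j → ψ≈χ (i , j)

  -- Transfers the complex inner product identities to the real-valued norm.
  ∥ψ∥²≈⟨ψ,ψ⟩ : ∀ (ψ : State n d) → ∥ ψ ∥² ≈ re ⟨ ψ , ψ ⟩
  ∥ψ∥²≈⟨ψ,ψ⟩ ψ = subst (∥ ψ ∥² ≈_) (sym (re-∑ᶜ (λ i → ∑ᶜ (λ j → term (i , j)))))
    (∑-cong (λ i → ∑ (λ j → ∣ ψ (i , j) ∣²)) (λ i → re (∑ᶜ (λ j → term (i , j)))) λ i →
      subst (∑ (λ j → ∣ ψ (i , j) ∣²) ≈_) (sym (re-∑ᶜ (λ j → term (i , j))))
        (∑-cong (λ j → ∣ ψ (i , j) ∣²) (λ j → re (term (i , j))) λ j → square (ψ (i , j))))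
    where
    term : Index n d → ℂ
    term s = conj (ψ s) *ᶜ ψ s

    square : ∀ z → ∣ z ∣² ≈ re (conj z *ᶜ z)
    square z@(a +i b) = pointwise {∣ z ∣²} {re (conj z *ᶜ z)} λ n → solve 2 (λ a b →
      a :* a :+ b :* b := a :* a :+ :- ((:- b) :* b)) refl (seq a n) (seq b n)

  𝟙-diagonal : ∀ s → 𝟙 {n} {d} s s ≡ 1ᶜ
  𝟙-diagonal (i , j) with i ≟ i | j ≟ j
  ... | yes _  | yes _  = refl
  ... | no i≢i | _      = contradiction refl i≢i
  ... | yes _  | no j≢j = contradiction refl j≢j

  𝟙-off-diagonal : ∀ s t → t ≢ s → 𝟙 {n} {d} s t ≡ 0ᶜ
  𝟙-off-diagonal (i , j) (i′ , j′) t≢s with i ≟ i′ | j ≟ j′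
  ... | yes refl | yes refl = contradiction refl t≢s
  ... | no _     | _        = refl
  ... | yes _    | no _     = refl

  𝟙-isIdentity : IsIdentity (𝟙 {n} {d})
  𝟙-isIdentity = (λ s → subst (_≈ᶜ 1ᶜ) (sym (𝟙-diagonal s)) (ℂR.refl {1ᶜ}))
    , (λ s t t≢s → subst (_≈ᶜ 0ᶜ) (sym (𝟙-off-diagonal s t t≢s)) (ℂR.refl {0ᶜ}))

  unitary-isometric : ∀ {U : Operator n d} → Unitary U → ∀ ψ → ∥ U · ψ ∥² ≈ ∥ ψ ∥²
  unitary-isometric {U} (U†U≋𝟙 , _) ψ =
    ≈-trans {∥ U · ψ ∥²} {re ⟨ U · ψ , U · ψ ⟩} {∥ ψ ∥²} (∥ψ∥²≈⟨ψ,ψ⟩ (U · ψ))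
      (≈-trans {re ⟨ U · ψ , U · ψ ⟩} {re ⟨ ψ , ψ ⟩} {∥ ψ ∥²}
        (proj₁ (isometric {U} {𝟙} 𝟙-isIdentity U†U≋𝟙 ψ))
        (≈-sym {∥ ψ ∥²} {re ⟨ ψ , ψ ⟩} (∥ψ∥²≈⟨ψ,ψ⟩ ψ)))

  unitary-injective : ∀ {U : Operator n d} → Unitary U → ∀ ψ → (∀ s → (U · ψ) s ≈ᶜ 0ᶜ) → ∀ s → ψ s ≈ᶜ 0ᶜ
  unitary-injective {U} (U†U≋𝟙 , _) = left-inverse⇒injective {U} {U †} {𝟙} 𝟙-isIdentity U†U≋𝟙

  module _ {Π : Bool → Operator n d} (measurement : IsProjectiveMeasurement Π) where
    open IsProjectiveMeasurement measurement

    measurement-complete : ∀ ψ s → (Π false · ψ) s +ᶜ (Π true · ψ) s ≈ᶜ ψ s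
    measurement-complete = resolution-· {Π false} {Π true} {𝟙} 𝟙-isIdentity complete

    measurement-norm : ∀ ψ → ∥ Π false · ψ ∥² +ʳ ∥ Π true · ψ ∥² ≈ ∥ ψ ∥²
    measurement-norm ψ =
      ≈-trans {∥ χ₀ ∥² +ʳ ∥ χ₁ ∥²} {re (⟨ χ₀ , χ₀ ⟩ +ᶜ ⟨ χ₁ , χ₁ ⟩)} {∥ ψ ∥²}
        (+-cong {∥ χ₀ ∥²} {re ⟨ χ₀ , χ₀ ⟩} {∥ χ₁ ∥²} {re ⟨ χ₁ , χ₁ ⟩} (∥ψ∥²≈⟨ψ,ψ⟩ χ₀) (∥ψ∥²≈⟨ψ,ψ⟩ χ₁))
        (≈-trans {re (⟨ χ₀ , χ₀ ⟩ +ᶜ ⟨ χ₁ , χ₁ ⟩)} {re ⟨ ψ , ψ ⟩} {∥ ψ ∥²}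
          (proj₁ (pythagoras {Π false} {Π true} {𝟙} (selfAdjoint false , idempotent false)
            (selfAdjoint true , idempotent true) 𝟙-isIdentity complete ψ))
          (≈-sym {∥ ψ ∥²} {re ⟨ ψ , ψ ⟩} (∥ψ∥²≈⟨ψ,ψ⟩ ψ)))
      where
      χ₀ = Π false · ψ
      χ₁ = Π true · ψ

  oracle-isometric : ∀ x (ψ : State n d) → ∥ oracle x ψ ∥² ≈ ∥ ψ ∥²
  oracle-isometric x ψ = ∥∥²-cong (oracle x ψ) ψ λ
    { (zero  , j) → keep (ψ (zero , j))
    ; (suc i , j) → flip (lookup x i) (ψ (suc i , j)) }
    where
    keep : ∀ z → ∣ 1ᶜ *ᶜ z ∣² ≈ ∣ z ∣²
    keep z = ∣∣²-cong (1ᶜ *ᶜ z) z (ℂR.*-identityˡ z)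

    flip : ∀ b z → ∣ (if b then -ᶜ 1ᶜ else 1ᶜ) *ᶜ z ∣² ≈ ∣ z ∣²
    flip false z = keep z
    flip true  z = ≈-trans {∣ (-ᶜ 1ᶜ) *ᶜ z ∣²} {∣ -ᶜ z ∣²} {∣ z ∣²}
      (∣∣²-cong ((-ᶜ 1ᶜ) *ᶜ z) (-ᶜ z) (-1*x≈-x z))
      (pointwise {∣ -ᶜ z ∣²} {∣ z ∣²} λ n → solve 2 (λ a b →
        (:- a) :* (:- a) :+ (:- b) :* (:- b) := a :* a :+ b :* b) refl (seq (re z) n) (seq (im z) n))

-- The query as a linear map

-- The phase of bit `i` is `1 - 2 xᵢ`; writing the constant as the leading coordinate of `∣P x ⟩₁`
-- turns this affine function into a linear form.
phaseForm : ∀ {n} → Vector ℝ (suc n) → Fin (suc n) → ℝ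
phaseForm w zero    = w zero
phaseForm w (suc i) = w zero +ʳ - (w (suc i) +ʳ w (suc i))

phaseForm-cong : ∀ {n} (u v : Vector ℝ (suc n)) → (∀ i → u i ≈ v i) → ∀ i → phaseForm u i ≈ phaseForm v i
phaseForm-cong u v u≈v zero    = u≈v zero
phaseForm-cong u v u≈v (suc i) =
  +-cong {u zero} {v zero} { - (a +ʳ a)} { - (b +ʳ b)} (u≈v zero)
    (-‿cong {a +ʳ a} {b +ʳ b} (+-cong {a} {b} {a} {b} (u≈v (suc i)) (u≈v (suc i))))
  where
  a = u (suc i)
  b = v (suc i)

phaseForm-+ : ∀ {n} (u v : Vector ℝ (suc n)) i →
  phaseForm (λ i → u i +ʳ v i) i ≈ phaseForm u i +ʳ phaseForm v i
phaseForm-+ u v zero    = ≈-refl {u zero +ʳ v zero}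
phaseForm-+ u v (suc i) =
  pointwise {phaseForm (λ i → u i +ʳ v i) (suc i)} {phaseForm u (suc i) +ʳ phaseForm v (suc i)} λ n →
    solve 4 (λ a b c e → (a :+ c) :+ :- ((b :+ e) :+ (b :+ e)) := (a :+ :- (b :+ b)) :+ (c :+ :- (e :+ e)))
      refl (seq (u zero) n) (seq (u (suc i)) n) (seq (v zero) n) (seq (v (suc i)) n)

phaseForm-* : ∀ {n} x (u : Vector ℝ (suc n)) i → phaseForm (λ i → x *ʳ u i) i ≈ x *ʳ phaseForm u i
phaseForm-* x u zero    = ≈-refl {x *ʳ u zero}
phaseForm-* x u (suc i) =
  pointwise {phaseForm (λ i → x *ʳ u i) (suc i)} {x *ʳ phaseForm u (suc i)} λ n →
    solve 3 (λ x a b → x :* a :+ :- (x :* b :+ x :* b) := x :* (a :+ :- (b :+ b)))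
      refl (seq x n) (seq (u zero) n) (seq (u (suc i)) n)

ι-cong : ∀ {x y} → x ≈ y → ι x ≈ᶜ ι y
ι-cong x≈y = x≈y , ≈-refl {0ℝ}

phase≈phaseForm : ∀ {n} d (x : Vec Bool n) i → phase {n} {d} x i ≈ᶜ ι (phaseForm ∣P x ⟩₁ i)
phase≈phaseForm d x zero    = ℂR.refl {1ᶜ}
phase≈phaseForm d x (suc i) with lookup x i
... | false = pointwise {1ℝ} {1ℝ +ʳ - (0ℝ +ʳ 0ℝ)} (λ n → refl) , ≈-refl {0ℝ}
... | true  = pointwise { - 1ℝ} {1ℝ +ʳ - (1ℝ +ʳ 1ℝ)} (λ n → refl) , pointwise { - 0ℝ} {0ℝ} (λ n → refl)

module _ {n d : ℕ} (φ : State n d) where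
  open Operators ℂ-ring (suc n) d using (··-cong; ··-+; ··-scale)

  -- The linear extension of x ↦ oracle x φ from the vectors ∣P x ⟩₁ to all of ℝⁿ⁺¹.
  linearOracle : Vector ℝ (suc n) → State n d
  linearOracle w (i , j) = ι (phaseForm w i) *ᶜ φ (i , j)

  linearOracle-cong : ∀ u v → (∀ i → u i ≈ v i) → ∀ s → linearOracle u s ≈ᶜ linearOracle v s
  linearOracle-cong u v u≈v (i , j) = ℂR.*-congʳ {φ (i , j)} {ι (phaseForm u i)} {ι (phaseForm v i)}
    (ι-cong {phaseForm u i} {phaseForm v i} (phaseForm-cong u v u≈v i))

  linearOracle-+ : ∀ u v s → linearOracle (λ i → u i +ʳ v i) s ≈ᶜ linearOracle u s +ᶜ linearOracle v s
  linearOracle-+ u v (i , j) = ℂR.trans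
    {ι (phaseForm (λ i → u i +ʳ v i) i) *ᶜ z} {(ι p +ᶜ ι q) *ᶜ z} {ι p *ᶜ z +ᶜ ι q *ᶜ z}
    (ℂR.*-congʳ {z} {ι (phaseForm (λ i → u i +ʳ v i) i)} {ι p +ᶜ ι q}
      (phaseForm-+ u v i , pointwise {0ℝ} {0ℝ +ʳ 0ℝ} (λ n → refl)))
    (ℂR.distribʳ z (ι p) (ι q))
    where
    z = φ (i , j)
    p = phaseForm u i
    q = phaseForm v i

  linearOracle-* : ∀ x u s → linearOracle (λ i → x *ʳ u i) s ≈ᶜ ι x *ᶜ linearOracle u s
  linearOracle-* x u (i , j) = ℂR.trans
    {ι (phaseForm (λ i → x *ʳ u i) i) *ᶜ z} {(ι x *ᶜ ι p) *ᶜ z} {ι x *ᶜ (ι p *ᶜ z)}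
    (ℂR.*-congʳ {z} {ι (phaseForm (λ i → x *ʳ u i) i)} {ι x *ᶜ ι p}
      (ℂR.trans {ι (phaseForm (λ i → x *ʳ u i) i)} {ι (x *ʳ p)} {ι x *ᶜ ι p}
        (ι-cong {phaseForm (λ i → x *ʳ u i) i} {x *ʳ p} (phaseForm-* x u i))
        (ℂR.sym {ι x *ᶜ ι p} {ι (x *ʳ p)}
          (ℂR.trans {ι x *ᶜ ι p} {(x *ʳ p) +i (x *ʳ 0ℝ)} {ι (x *ʳ p)} (ι-* x (ι p))
            (≈-refl {x *ʳ p} , ℝR.zeroʳ x)))))
    (ℂR.*-assoc (ι x) (ι p) z)
    where
    z = φ (i , j)
    p = phaseForm u i

  oracle≈linearOracle : ∀ x s → oracle x φ s ≈ᶜ linearOracle ∣P x ⟩₁ s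
  oracle≈linearOracle x (i , j) =
    ℂR.*-congʳ {φ (i , j)} {phase {n} {d} x i} {ι (phaseForm ∣P x ⟩₁ i)} (phase≈phaseForm d x i)

  module _ (A B : Operator n d) where

    -- For `A` the measurement operator `Π c` and `B` the unitary after the query, this is the
    -- kernel of T_c.
    Annihilated : Vector ℝ (suc n) → Set
    Annihilated w = ∀ s → (A · B · linearOracle w) s ≈ᶜ 0ᶜ

    amplitude-* : ∀ x u s →
      (A · B · linearOracle (λ i → x *ʳ u i)) s ≈ᶜ ι x *ᶜ (A · B · linearOracle u) s
    amplitude-* x u s = ℂR.trans
      {(A · B · linearOracle (λ i → x *ʳ u i)) s} {(A · B · (λ t → ι x *ᶜ linearOracle u t)) s}
      {ι x *ᶜ (A · B · linearOracle u) s}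
      (··-cong A B {linearOracle (λ i → x *ʳ u i)} {λ t → ι x *ᶜ linearOracle u t} (linearOracle-* x u) s)
      (··-scale A B (ι x) (linearOracle u) s)

    annihilated-isSubspace : IsSubspace Annihilated
    annihilated-isSubspace = record
      { resp = λ {u} {v} → resp u v
      ; 0∈   = 0∈
      ; +∈   = λ {u} {v} → +∈ u v
      ; *∈   = λ x {u} → *∈ x u }
      where
      resp : ∀ u v → (∀ i → u i ≈ v i) → Annihilated u → Annihilated v
      resp u v u≈v u∈ s = ℂR.trans {(A · B · linearOracle v) s} {(A · B · linearOracle u) s} {0ᶜ}
        (··-cong A B {linearOracle v} {linearOracle u}
          (linearOracle-cong v u λ i → ≈-sym {u i} {v i} (u≈v i)) s) (u∈ s)

      *∈ : ∀ x u → Annihilated u → Annihilated (λ i → x *ʳ u i)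
      *∈ x u u∈ s = ℂR.trans {(A · B · linearOracle (λ i → x *ʳ u i)) s} {ι x *ᶜ a} {0ᶜ}
        (amplitude-* x u s)
        (ℂR.trans {ι x *ᶜ a} {ι x *ᶜ 0ᶜ} {0ᶜ} (ℂR.*-congˡ {ι x} {a} {0ᶜ} (u∈ s)) (ℂR.zeroʳ (ι x)))
        where a = (A · B · linearOracle u) s

      +∈ : ∀ u v → Annihilated u → Annihilated v → Annihilated (λ i → u i +ʳ v i)
      +∈ u v u∈ v∈ s = ℂR.trans
        {(A · B · linearOracle (λ i → u i +ʳ v i)) s}
        {(A · B · (λ t → linearOracle u t +ᶜ linearOracle v t)) s} {0ᶜ}
        (··-cong A B {linearOracle (λ i → u i +ʳ v i)} {λ t → linearOracle u t +ᶜ linearOracle v t}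
          (linearOracle-+ u v) s)
        (ℂR.trans {(A · B · (λ t → linearOracle u t +ᶜ linearOracle v t)) s} {a +ᶜ b} {0ᶜ}
          (··-+ A B (linearOracle u) (linearOracle v) s)
          (ℂR.trans {a +ᶜ b} {0ᶜ +ᶜ 0ᶜ} {0ᶜ} (ℂR.+-cong {a} {0ᶜ} {b} {0ᶜ} (u∈ s) (v∈ s)) (ℂR.+-identityˡ 0ᶜ)))
        where
        a = (A · B · linearOracle u) s
        b = (A · B · linearOracle v) s

      0∈ : Annihilated (λ _ → 0ℝ)
      -- The zero vector is rewritten as zero times itself, so that homogeneity applies.
      0∈ s = ℂR.trans {(A · B · linearOracle (λ _ → 0ℝ)) s} {(A · B · linearOracle (λ i → 0ℝ *ʳ 0ℝ)) s} {0ᶜ}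
        (··-cong A B {linearOracle (λ _ → 0ℝ)} {linearOracle (λ i → 0ℝ *ʳ 0ℝ)}
          (linearOracle-cong (λ _ → 0ℝ) (λ i → 0ℝ *ʳ 0ℝ) λ i → pointwise {0ℝ} {0ℝ *ʳ 0ℝ} (λ n → refl)) s)
        (ℂR.trans {(A · B · linearOracle (λ i → 0ℝ *ʳ 0ℝ)) s} {ι 0ℝ *ᶜ a} {0ᶜ}
          (amplitude-* 0ℝ (λ _ → 0ℝ) s) (ℂR.zeroˡ a))
        where a = (A · B · linearOracle (λ _ → 0ℝ)) s

∥ψ∥²≈0 : ∀ {n d} (ψ : State n d) → (∀ s → ψ s ≈ᶜ 0ᶜ) → ∥ ψ ∥² ≈ 0ℝ
∥ψ∥²≈0 ψ ψ≈0 = sum-≈0 (λ i → ∑ (λ j → ∣ ψ (i , j) ∣²)) λ i →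
  sum-≈0 (λ j → ∣ ψ (i , j) ∣²) λ j →
    ≈-trans {∣ ψ (i , j) ∣²} {∣ 0ᶜ ∣²} {0ℝ} (∣∣²-cong (ψ (i , j)) 0ᶜ (ψ≈0 (i , j)))
      (pointwise {∣ 0ᶜ ∣²} {0ℝ} (λ n → refl))
  where open Sums ℝ-ring using (sum-≈0)

x∈cube : ∀ {n} (x : Vec Bool n) → x ∈ˡ cube n
x∈cube []              = here refl
x∈cube (false ∷ x)     = ∈-++⁺ˡ (∈-map⁺ (false ∷_) (x∈cube x))
x∈cube {suc n} (true ∷ x) = ∈-++⁺ʳ (List.map (false ∷_) (cube n)) (∈-map⁺ (true ∷_) (x∈cube x))

-- Columns of the matrices and unqueried bits

module _ {n : ℕ} (f : PartialBooleanFunction n) (b : Bool) where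

  column : Fin (length (fibre f b)) → Vec Bool n
  column = List.lookup (fibre f b)

  fibre-sound : ∀ j → f (column j) ≡ just b
  fibre-sound j = proj₂ (∈-filter⁻ (λ x → Maybe.≡-dec Bool._≟_ (f x) (just b)) {xs = cube n} (∈-lookup j))

  -- A single column is independent because its leading entry is one, so row `zero` of a relation
  -- isolates the coefficient.
  1≤rank : ∀ {x r} → f x ≡ just b → IsRank (G₁ f b) r → 1 ≤ r
  1≤rank {x} fx≡b (_ , maximal) = maximal 1 ((λ _ → index x∈fibre) , λ
    { a a·G≈0 zero → ≈-trans {a zero} {a zero *ʳ 1ℝ +ʳ 0ℝ} {0ℝ}
        (≈-sym {a zero *ʳ 1ℝ +ʳ 0ℝ} {a zero} (≈-trans {a zero *ʳ 1ℝ +ʳ 0ℝ} {a zero *ʳ 1ℝ} {a zero}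
          (ℝR.+-identityʳ (a zero *ʳ 1ℝ)) (ℝR.*-identityʳ (a zero))))
        (a·G≈0 zero) })
    where
    x∈fibre : x ∈ˡ fibre f b
    x∈fibre = ∈-filter⁺ (λ x → Maybe.≡-dec Bool._≟_ (f x) (just b)) (x∈cube x) fx≡b

surjective : ∀ {n} {f : PartialBooleanFunction n} → NonConstant f → ∀ b → ∃[ x ] f x ≡ just b
surjective (x , y , b , c , fx≡b , fy≡c , b≢c) e with b Bool.≟ e
... | yes refl = x , fx≡b
... | no  b≢e  = y , trans fy≡c
  (cong just (trans (Bool.¬-not (b≢c ∘ sym)) (sym (Bool.¬-not (b≢e ∘ sym)))))

-- The leading coordinate is outside `false ∷ V` and so vanishes. For `i` in `V` the vanishing form
-- then leaves twice `w (suc i)` equal to zero.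
phaseForm-determines : ∀ {n} (V : Subset n) (w : Vector ℝ (suc n)) →
  (∀ i → i ∈ V → phaseForm w (suc i) ≈ 0ℝ) → (∀ i → i ∉ false ∷ V → w i ≈ 0ℝ) → ∀ i → w i ≈ 0ℝ
phaseForm-determines V w form≈0 w≈0 zero    = w≈0 zero λ ()
phaseForm-determines V w form≈0 w≈0 (suc i) with i ∈? V
... | no  i∉V = w≈0 (suc i) λ { (Vec.there i∈V) → i∉V i∈V }
... | yes i∈V = half-cancel (w (suc i))
  (≈-trans {a} {w zero +ʳ - (w zero +ʳ - a)} {0ℝ}
    (pointwise {a} {w zero +ʳ - (w zero +ʳ - a)} λ n →
      solve 2 (λ a z → a := z :+ :- (z :+ :- a)) refl (seq a n) (seq (w zero) n))
    (x-y≈0 {w zero} {w zero +ʳ - a} (≈-trans {w zero} {0ℝ} {w zero +ʳ - a} (w≈0 zero λ ())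
      (≈-sym {w zero +ʳ - a} {0ℝ} (form≈0 i i∈V)))))
  where
  a : ℝ
  a = w (suc i) +ʳ w (suc i)

-- Changing bit `i` changes only the phases of the amplitudes at `suc i`, which are zero.
oracle-ignores : ∀ {n d} (φ : State n d) i → (∀ j → φ (suc i , j) ≈ᶜ 0ᶜ) →
  ∀ x s → oracle (x [ i ]≔ true) φ s ≈ᶜ oracle (x [ i ]≔ false) φ s
oracle-ignores φ i φᵢ≈0 x (zero , j)  = ℂR.refl {1ᶜ *ᶜ φ (zero , j)}
oracle-ignores {n} {d} φ i φᵢ≈0 x (suc l , j) with l ≟ i
... | yes refl = ℂR.trans {p true *ᶜ z} {0ᶜ} {p false *ᶜ z} (vanishes true)
  (ℂR.sym {p false *ᶜ z} {0ᶜ} (vanishes false))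
  where
  z : ℂ
  z = φ (suc i , j)

  p : Bool → ℂ
  p b = phase {n} {d} (x [ i ]≔ b) (suc i)

  vanishes : ∀ b → p b *ᶜ z ≈ᶜ 0ᶜ
  vanishes b = ℂR.trans {p b *ᶜ z} {p b *ᶜ 0ᶜ} {0ᶜ} (ℂR.*-congˡ {p b} {z} {0ᶜ} (φᵢ≈0 j)) (ℂR.zeroʳ (p b))
... | no l≢i
  rewrite lookup∘update′ l≢i x true | lookup∘update′ l≢i x false =
  ℂR.refl {(if lookup x l then -ᶜ 1ᶜ else 1ᶜ) *ᶜ φ (suc l , j)}

∥··∥²-cong : ∀ {n d} (A B : Operator n d) (ψ χ : State n d) → (∀ s → ψ s ≈ᶜ χ s) →
  ∥ A · B · ψ ∥² ≈ ∥ A · B · χ ∥²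
∥··∥²-cong {n} {d} A B ψ χ ψ≈χ = ∥∥²-cong (A · B · ψ) (A · B · χ) λ s →
  ∣∣²-cong ((A · B · ψ) s) ((A · B · χ) s)
    (Operators.··-cong ℂ-ring (suc n) d A B {ψ} {χ} ψ≈χ s)

-- Rank bounds from an exact query

module ExactQuery {n d : ℕ} (f : PartialBooleanFunction n)
  (φ : State n d) (φ-unit : ∥ φ ∥² ≈ 1ℝ)
  (U : Operator n d) (U-unitary : Unitary U)
  (Π : Bool → Operator n d) (Π-measurement : IsProjectiveMeasurement Π)
  (exact : ∀ x b → f x ≡ just b → ∥ Π b · U · oracle x φ ∥² ≈ 1ℝ) where
  open Operators ℂ-ring (suc n) d using (··-cong)

  final : Vec Bool n → State n d
  final x = U · oracle x φ

  probability : Vec Bool n → Bool → ℝ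
  probability x b = ∥ Π b · final x ∥²

  -- Stated as a negated vanishing instead of the existence of a nonzero amplitude: constructively
  -- no witness `j` can be extracted, and stability works with this form.
  Queried : Fin n → Set
  Queried i = ¬ (∀ j → φ (suc i , j) ≈ᶜ 0ᶜ)

  W : Bool → Vector ℝ (suc n) → Set
  W c = Annihilated φ (Π c) U

  isSubspace : ∀ c → IsSubspace (W c)
  isSubspace c = annihilated-isSubspace φ (Π c) U

  final-linear : ∀ c x s → (Π c · final x) s ≈ᶜ (Π c · U · linearOracle φ ∣P x ⟩₁) s
  final-linear c x = ··-cong (Π c) U {oracle x φ} {linearOracle φ ∣P x ⟩₁} (oracle≈linearOracle φ x)

  total-probability : ∀ x → probability x false +ʳ probability x true ≈ 1ℝ
  total-probability x =
    ≈-trans {probability x false +ʳ probability x true} {∥ final x ∥²} {1ℝ}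
      (measurement-norm {n} {d} {Π} Π-measurement (final x))
      (≈-trans {∥ final x ∥²} {∥ oracle x φ ∥²} {1ℝ} (unitary-isometric {n} {d} {U} U-unitary (oracle x φ))
        (≈-trans {∥ oracle x φ ∥²} {∥ φ ∥²} {1ℝ} (oracle-isometric {n} {d} x φ) φ-unit))

  complementary : ∀ p q → p +ʳ q ≈ 1ℝ → p ≈ 1ℝ → q ≈ 0ℝ
  complementary p q p+q≈1 p≈1 =
    ≈-trans {q} {p +ʳ q +ʳ - p} {0ℝ}
      (pointwise {q} {p +ʳ q +ʳ - p} λ n →
        solve 2 (λ p q → q := p :+ q :+ :- p) refl (seq p n) (seq q n))
      (x-y≈0 {p +ʳ q} {p} (≈-trans {p +ʳ q} {1ℝ} {p} p+q≈1 (≈-sym {p} {1ℝ} p≈1)))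

  wrong-outcome : ∀ {x b c} → f x ≡ just b → b ≢ c → probability x c ≈ 0ℝ
  wrong-outcome {x} {false} {false} fx b≢c = contradiction refl b≢c
  wrong-outcome {x} {true}  {true}  fx b≢c = contradiction refl b≢c
  wrong-outcome {x} {false} {true}  fx _   =
    complementary (probability x false) (probability x true) (total-probability x) (exact x false fx)
  wrong-outcome {x} {true}  {false} fx _   =
    complementary (probability x true) (probability x false)
      (≈-trans {probability x true +ʳ probability x false} {probability x false +ʳ probability x true} {1ℝ}
        (ℝR.+-comm (probability x true) (probability x false)) (total-probability x))
      (exact x true fx)

  -- The wrong outcome has probability zero since the probabilities sum to one, and a vector of norm
  -- zero vanishes.
  annihilates : ∀ {x b c} → f x ≡ just b → b ≢ c → W c ∣P x ⟩₁
  annihilates {x} {b} {c} fx b≢c s = ℂR.trans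
    {(Π c · U · linearOracle φ ∣P x ⟩₁) s} {(Π c · final x) s} {0ᶜ}
    (ℂR.sym {(Π c · final x) s} {(Π c · U · linearOracle φ ∣P x ⟩₁) s} (final-linear c x s))
    (∥ψ∥²≈0⇒ψ≈0 {n} {d} (Π c · final x) (wrong-outcome {x} {b} {c} fx b≢c) s)

  -- For nonzero `x` the scalar would cancel, so the component of the correct outcome would vanish
  -- although its probability is one. This is the form of non-membership that `independent-proper`
  -- requires.
  ¬annihilates : ∀ {y c} → f y ≡ just c → ∀ x → W c (λ i → x *ʳ ∣P y ⟩₁ i) → x ≈ 0ℝ
  ¬annihilates {y} {c} fy x xy∈ = ≈0-stable x λ x≉0 → 1≉0
    (≈-trans {1ℝ} {probability y c} {0ℝ} (≈-sym {probability y c} {1ℝ} (exact y c fy))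
      (∥ψ∥²≈0 {n} {d} (Π c · final y) λ s → ℂR.trans
        {(Π c · final y) s} {(Π c · U · linearOracle φ ∣P y ⟩₁) s} {0ᶜ} (final-linear c y s)
        (*ᶜ-cancel-≉0 x ((Π c · U · linearOracle φ ∣P y ⟩₁) s)
          (ℂR.trans {ι x *ᶜ (Π c · U · linearOracle φ ∣P y ⟩₁) s}
            {(Π c · U · linearOracle φ (λ i → x *ʳ ∣P y ⟩₁ i)) s} {0ᶜ}
            (ℂR.sym {(Π c · U · linearOracle φ (λ i → x *ʳ ∣P y ⟩₁ i)) s}
              {ι x *ᶜ (Π c · U · linearOracle φ ∣P y ⟩₁) s} (amplitude-* φ (Π c) U x ∣P y ⟩₁ s))
            (xy∈ s)) x≉0)))

  -- The columns with value `b` lie in `W c`, and `∣P y ⟩₁` shows that `W c` is a proper subspace of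
  -- a space of dimension `n + 1`.
  rank≤n : ∀ {b c y r} → b ≢ c → f y ≡ just c → IsRank (G₁ f b) r → r ≤ n
  rank≤n {b} {c} {y} {r} b≢c fy ((J , ind) , _) = ℕ.≤-pred
    (independent-proper {r} {suc n} {0ℓ} {W c} (isSubspace c) ∣P y ⟩₁ (¬annihilates {y} {c} fy)
      (λ j → ∣P column f b (J j) ⟩₁) ind
      (λ j → annihilates {column f b (J j)} {b} {c} (fibre-sound f b (J j)) b≢c))

  -- Both measurement components of `χ` vanish, hence so does `χ`, and then `linearOracle φ w` by
  -- injectivity of `U`. A nonzero form at `suc i` would cancel and make every amplitude there zero,
  -- contradicting that `i` is queried.
  W∩W⇒phaseForm≈0 : ∀ w → W true w → W false w → ∀ i → Queried i → phaseForm w (suc i) ≈ 0ℝ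
  W∩W⇒phaseForm≈0 w w∈₁ w∈₀ i queried = ≈0-stable (phaseForm w (suc i)) λ p≉0 →
    queried λ j → *ᶜ-cancel-≉0 (phaseForm w (suc i)) (φ (suc i , j))
      (unitary-injective {n} {d} {U} U-unitary (linearOracle φ w) Uχ≈0 (suc i , j)) p≉0
    where
    χ : State n d
    χ = U · linearOracle φ w

    Uχ≈0 : ∀ s → χ s ≈ᶜ 0ᶜ
    Uχ≈0 s = ℂR.trans {χ s} {(Π false · χ) s +ᶜ (Π true · χ) s} {0ᶜ}
      (ℂR.sym {(Π false · χ) s +ᶜ (Π true · χ) s} {χ s} (measurement-complete {n} {d} {Π} Π-measurement χ s))
      (ℂR.trans {(Π false · χ) s +ᶜ (Π true · χ) s} {0ᶜ +ᶜ 0ᶜ} {0ᶜ}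
        (ℂR.+-cong {(Π false · χ) s} {0ᶜ} {(Π true · χ) s} {0ᶜ} (w∈₀ s) (w∈₁ s)) (ℂR.+-identityˡ 0ᶜ))

  determined : ∀ V → (∀ i → (i ∈ V) ⇔ Queried i) → ∀ w → W true w → W false w →
    (∀ i → i ∉ false ∷ V → w i ≈ 0ℝ) → ∀ i → w i ≈ 0ℝ
  determined V V⇔queried w w∈₁ w∈₀ w≈0 = phaseForm-determines V w
    (λ i i∈V → W∩W⇒phaseForm≈0 w w∈₁ w∈₀ i (Equivalence.to (V⇔queried i) i∈V)) w≈0

  ignores-unqueried : ∀ i → ¬ Queried i → Ignores i (λ x → probability x true)
  ignores-unqueried i ¬queried x =
    ∥··∥²-cong {n} {d} (Π true) U (oracle (x [ i ]≔ true) φ) (oracle (x [ i ]≔ false) φ)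
      (oracle-ignores φ i φᵢ≈0 x)
    where
    φᵢ≈0 : ∀ j → φ (suc i , j) ≈ᶜ 0ᶜ
    -- Not being queried is only a double negation of vanishing; stability of the real and imaginary
    -- parts removes it.
    φᵢ≈0 j = ≈0-stable (re (φ (suc i , j))) (λ re≉0 → ¬queried λ φᵢ≈0 → re≉0 (proj₁ (φᵢ≈0 j)))
           , ≈0-stable (im (φ (suc i , j))) (λ im≉0 → ¬queried λ φᵢ≈0 → im≉0 (proj₂ (φᵢ≈0 j)))

  probability≈f : ∀ x b → f x ≡ just b → probability x true ≈ bit b
  probability≈f x true  fx = exact x true fx
  probability≈f x false fx = wrong-outcome {x} {false} {true} fx λ ()

  -- The set of queried bits bounds `k` from above by its size and bounds the intersection of the
  -- two kernels. Placing `k` on the left postpones truncated subtraction.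
  rank-sum : ∀ {k r₀ r₁} → DependsOnBits f k → IsRank (G₁ f false) r₀ → IsRank (G₁ f true) r₁ →
    r₀ + r₁ + k ≤ suc n + suc n
  rank-sum {k} {r₀} {r₁} dep ((J₀ , ind₀) , _) ((J₁ , ind₁) , _) =
    decidable-stable (r₀ + r₁ + k ℕ.≤? suc n + suc n) (¬¬-map bound (¬¬-comprehension Queried))
    where
    bound : ∃[ V ] (∀ i → (i ∈ V) ⇔ Queried i) → r₀ + r₁ + k ≤ suc n + suc n
    bound (V , V⇔queried) = ℕ.≤-trans
      (ℕ.+-monoʳ-≤ (r₀ + r₁) (dependsOnBits⇒≤ dep (λ x → probability x true) probability≈f V
        λ i i∉V → ignores-unqueried i (i∉V ∘ Equivalence.from (V⇔queried i))))
      -- Columns with value `false` lie in `W true` and vice versa. The leading `false` shifts bits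
      -- to coordinates and leaves the size of `V` unchanged.
      (independent-sum {r₀} {r₁} {suc n} {0ℓ} {W true} {W false}
        (isSubspace true) (isSubspace false) (false ∷ V) (determined V V⇔queried)
        (λ j → ∣P column f false (J₀ j) ⟩₁) ind₀
        (λ j → annihilates {column f false (J₀ j)} {false} {true} (fibre-sound f false (J₀ j)) λ ())
        (λ j → ∣P column f true (J₁ j) ⟩₁) ind₁
        (λ j → annihilates {column f true (J₁ j)} {true} {false} (fibre-sound f true (J₁ j)) λ ()))

theorem4 : ∀ (n k : ℕ) (f : PartialBooleanFunction n) → NonConstant f → DependsOnBits f k → OneQueryComputable f →
    ∀ (r₀ r₁ : ℕ) → IsRank (G₁ f false) r₀ → IsRank (G₁ f true) r₁ →
    (1 ≤ r₀ × r₀ ≤ n) × (1 ≤ r₁ × r₁ ≤ n) × (r₀ + r₁ ≤ 2 * n + 2 ∸ k)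
theorem4 n k f nonConstant dep (A , exact) r₀ r₁ rank₀ rank₁ =
    (1≤rank f false fx₀ rank₀ , rank≤n {false} {true} (λ ()) fx₁ rank₀)
  , (1≤rank f true fx₁ rank₁ , rank≤n {true} {false} (λ ()) fx₀ rank₁)
  -- The additive bound also shows that `k` is at most `2 * n + 2`, so the truncated subtraction is
  -- a true one.
  , ℕ.m+n≤o⇒m≤o∸n (r₀ + r₁) (subst (r₀ + r₁ + k ≤_) 2n+2 (rank-sum dep rank₀ rank₁))
  where
  open OneQueryAlgorithm A
  -- Everything before the query is absorbed into one state, still of unit norm because `U₀` is
  -- unitary.
  open ExactQuery f (U₀ · initial)
    (≈-trans {∥ U₀ · initial ∥²} {∥ initial ∥²} {1ℝ}
      (unitary-isometric {n} {d} {U₀} U₀-unitary initial) initial-unit)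
    U₁ U₁-unitary Π Π-measurement exact using (rank≤n; rank-sum)

  fx₀ = proj₂ (surjective nonConstant false)
  fx₁ = proj₂ (surjective nonConstant true)

  2n+2 : suc n + suc n ≡ 2 * n + 2
  2n+2 = trans (cong suc (ℕ.+-suc n n))
    (trans (cong (λ m → 2 + (n + m)) (sym (ℕ.+-identityʳ n))) (ℕ.+-comm 2 (2 * n)))
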